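{- Let $A$ be a finite alphabet, $0\le k\le n$ integers, and $a_1,\ldots,a_n\in A$. Then $$a_1\cdots a_k\sqcup\!\sqcup_q a_{k+1}\cdots a_n=\sum_{\substack{\pi\in S_n:\ \pi(1)<\cdots<\pi(k),\\ \pi(k+1)<\cdots<\pi(n)}} q^{\operatorname{inv}(\pi)}\,a_{\pi^{ -1}(1)}\cdots a_{\pi^{ -1}(n)},$$ and in particular the $q$-shuffle $\sqcup\!\sqcup_q$ is associative.
   Context: $A^*$ is the free monoid of finite words over $A$ (with concatenation and empty word $\varepsilon$), and $|w|$ is the length of a word $w$. $\mathbb{N}[q]\langle A^*\rangle$ is the set of finite formal sums of words with coefficients in $\mathbb{N}[q]$; for $s\in\mathbb{N}[q]\langle A^*\rangle$ and a letter $a$, $sa$ denotes the polynomial obtained by appending $a$ to each word of $s$. The $q$-shuffle $u\sqcup\!\sqcup_q v\in\mathbb{N}[q]\langle A^*\rangle$ of two words is defined recursively by $u\sqcup\!\sqcup_q\varepsilon=\varepsilon\sqcup\!\sqcup_q u=u$ and, for $u,v\in A^*$, $a,b\in A$, $$ua\sqcup\!\sqcup_q vb=q^{|vb|}(u\sqcup\!\sqcup_q vb)a+(ua\sqcup\!\sqcup_q v)b,$$ and it is extended bilinearly to $\mathbb{N}[q]\langle A^*\rangle$. $S_n$ is the symmetric group on $\{1,\ldots,n\}$ and $\operatorname{inv}(\pi)=\#\{1\le i<j\le n:\pi(i)>\pi(j)\}$. -}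

module Defs where

open import Data.Fin as Fin using (Fin; toℕ; fromℕ)
import Data.Fin.Properties as Fin
open import Data.Fin.Permutation as Perm
  using (Permutation′; _⟨$⟩ʳ_; _⟨$⟩ˡ_; insert; remove; insert-remove; remove-insert;
         inverseˡ; inverseʳ)
open import Data.List.Base as List
  using (List; []; _∷_; [_]; _++_; _∷ʳ_; map; concatMap; filter; length; replicate;
         allFin; cartesianProduct; cartesianProductWith; tabulate)
open import Data.List.Properties using (≡-dec; ∷ʳ-injective)
open import Data.List.Membership.Propositional using (_∈_; find)
open import Data.List.Membership.Propositional.Properties
  using (∈-cartesianProductWith⁺; ∈-allFin)
open import Data.List.Relation.Unary.All as All using (All; []; _∷_)
import Data.List.Relation.Unary.All.Properties as All
open import Data.List.Relation.Unary.Any using (here)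
open import Data.List.Relation.Unary.AllPairs as AllPairs using (AllPairs; []; _∷_)
import Data.List.Relation.Unary.AllPairs.Properties as AllPairs
open import Data.List.Relation.Unary.Unique.Propositional using (Unique)
open import Data.List.Relation.Unary.Unique.Propositional.Properties using (allFin⁺)
open import Data.List.Reverse using (Reverse; []; _∶_∶ʳ_; reverseView)
open import Data.Nat as ℕ using (ℕ; zero; suc)
import Data.Nat.Properties as ℕ
open import Data.Product using (_×_; _,_; ∃-syntax; proj₁; proj₂)
open import Function using (_↔_; _∘_)
open import Function.Properties.Inverse using (↔⇒↣)
open import Level using (Level)
open import Relation.Binary.Definitions using (DecidableEquality)
open import Relation.Binary.PropositionalEquality
  using (_≡_; refl; sym; trans; cong; cong₂; subst; setoid)
open import Relation.Nullary using (Dec; yes; no; ¬_; contradiction)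
open import Relation.Nullary.Decidable using (_×-dec_; _→-dec_)

private
  variable
    a : Level
    A : Set a
    m n : ℕ

-- A polynomial is its list of coefficients, constant term first; trailing
-- zeros are allowed, so polynomials are compared by _≈ᵖ_ rather than _≡_.
ℕ[q] : Set
ℕ[q] = List ℕ

coeff : ℕ[q] → ℕ → ℕ
coeff []      _       = 0
coeff (c ∷ p) zero    = c
coeff (c ∷ p) (suc i) = coeff p i

infix 4 _≈ᵖ_
_≈ᵖ_ : ℕ[q] → ℕ[q] → Set
p ≈ᵖ r = ∀ i → coeff p i ≡ coeff r i

infixl 6 _+ᵖ_
_+ᵖ_ : ℕ[q] → ℕ[q] → ℕ[q]
[]      +ᵖ r       = r
(c ∷ p) +ᵖ []      = c ∷ p
(c ∷ p) +ᵖ (d ∷ r) = (c ℕ.+ d) ∷ (p +ᵖ r)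

infixl 7 _*ᵖ_
_*ᵖ_ : ℕ[q] → ℕ[q] → ℕ[q]
[]      *ᵖ r = []
(c ∷ p) *ᵖ r = map (c ℕ.*_) r +ᵖ (0 ∷ p *ᵖ r)

infix 8 q^_
q^_ : ℕ → ℕ[q]
q^ k = replicate k 0 ∷ʳ 1

-- A formal sum is a list of terms p·w, in which a word may occur several
-- times; _≈[_]_ below compares the total coefficient of every word.
ℕ[q]⟨_*⟩ : Set a → Set a
ℕ[q]⟨ A *⟩ = List (ℕ[q] × List A)

word : List A → ℕ[q]⟨ A *⟩
word w = [ q^ 0 , w ]

infixl 6 _⊕_
_⊕_ : ℕ[q]⟨ A *⟩ → ℕ[q]⟨ A *⟩ → ℕ[q]⟨ A *⟩
_⊕_ = _++_

infixr 7 _·_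
_·_ : ℕ[q] → ℕ[q]⟨ A *⟩ → ℕ[q]⟨ A *⟩
p · s = map (λ (r , w) → p *ᵖ r , w) s

infixl 8 _◃_
_◃_ : ℕ[q]⟨ A *⟩ → A → ℕ[q]⟨ A *⟩
s ◃ x = map (λ (r , w) → r , w ∷ʳ x) s

coefficient : DecidableEquality A → ℕ[q]⟨ A *⟩ → List A → ℕ[q]
coefficient _≟_ s w =
  List.foldr _+ᵖ_ [] (map proj₁ (filter (λ (_ , u) → ≡-dec _≟_ u w) s))

-- Finiteness of the alphabet supplies the decidable equality of letters
-- needed to collect equal words.
infix 4 _≈[_]_
_≈[_]_ : ℕ[q]⟨ A *⟩ → A ↔ Fin m → ℕ[q]⟨ A *⟩ → Set _
s ≈[ finite ] t = ∀ w → coefficient _≟_ s w ≈ᵖ coefficient _≟_ t w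
  where _≟_ = Fin.inj⇒≟ (↔⇒↣ finite)

-- Words are consumed from the right, by structural recursion on the
-- last-letter view of both words.
shuffle : {u v : List A} → Reverse u → Reverse v → ℕ[q]⟨ A *⟩
shuffle {u = u} ru [] = word u
shuffle {v = v} [] (_ ∶ _ ∶ʳ _) = word v
shuffle ru′@(u ∶ ru ∶ʳ x) rv′@(v ∶ rv ∶ʳ y) =
  q^ (length (v ∷ʳ y)) · shuffle ru rv′ ◃ x ⊕ shuffle ru′ rv ◃ y

infixl 7 _⧢_
_⧢_ : List A → List A → ℕ[q]⟨ A *⟩
u ⧢ v = shuffle (reverseView u) (reverseView v)

infixl 7 _⧢̂_
_⧢̂_ : ℕ[q]⟨ A *⟩ → ℕ[q]⟨ A *⟩ → ℕ[q]⟨ A *⟩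
s ⧢̂ t = concatMap (λ (p , u) → concatMap (λ (r , v) → (p *ᵖ r) · (u ⧢ v)) t) s

private
  shuffle-irrelevant : {u u′ v v′ : List A}
    (ru : Reverse u) (ru′ : Reverse u′) (rv : Reverse v) (rv′ : Reverse v′) →
    u ≡ u′ → v ≡ v′ → shuffle ru rv ≡ shuffle ru′ rv′
  shuffle-irrelevant ru ru′ [] [] refl _ = refl
  shuffle-irrelevant ru ru′ [] ([] ∶ _ ∶ʳ _) _ ()
  shuffle-irrelevant ru ru′ [] ((_ ∷ _) ∶ _ ∶ʳ _) _ ()
  shuffle-irrelevant ru ru′ ([] ∶ _ ∶ʳ _) [] _ ()
  shuffle-irrelevant ru ru′ ((_ ∷ _) ∶ _ ∶ʳ _) [] _ ()
  shuffle-irrelevant [] [] (_ ∶ _ ∶ʳ _) (_ ∶ _ ∶ʳ _) _ eq = cong word eq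
  shuffle-irrelevant [] ([] ∶ _ ∶ʳ _) (_ ∶ _ ∶ʳ _) (_ ∶ _ ∶ʳ _) ()
  shuffle-irrelevant [] ((_ ∷ _) ∶ _ ∶ʳ _) (_ ∶ _ ∶ʳ _) (_ ∶ _ ∶ʳ _) ()
  shuffle-irrelevant ([] ∶ _ ∶ʳ _) [] (_ ∶ _ ∶ʳ _) (_ ∶ _ ∶ʳ _) ()
  shuffle-irrelevant ((_ ∷ _) ∶ _ ∶ʳ _) [] (_ ∶ _ ∶ʳ _) (_ ∶ _ ∶ʳ _) ()
  shuffle-irrelevant (u ∶ ru ∶ʳ x) (u′ ∶ ru′ ∶ʳ x′) (v ∶ rv ∶ʳ y) (v′ ∶ rv′ ∶ʳ y′) p r =
    trans
      (cong₂ (λ s t → q^ (length (v ∷ʳ y)) · s ◃ x ⊕ t ◃ y)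
        (shuffle-irrelevant ru ru′ (v ∶ rv ∶ʳ y) (v′ ∶ rv′ ∶ʳ y′) (proj₁ (∷ʳ-injective u u′ p)) r)
        (shuffle-irrelevant (u ∶ ru ∶ʳ x) (u′ ∶ ru′ ∶ʳ x′) rv rv′ p (proj₁ (∷ʳ-injective v v′ r))))
      (cong₂ (λ (w , x) y → q^ (length w) · shuffle ru′ (v′ ∶ rv′ ∶ʳ y′) ◃ x
                              ⊕ shuffle (u′ ∶ ru′ ∶ʳ x′) rv′ ◃ y)
        (cong₂ _,_ r (proj₂ (∷ʳ-injective u u′ p)))
        (proj₂ (∷ʳ-injective v v′ r)))

⧢-identityʳ : (u : List A) → u ⧢ [] ≡ word u
⧢-identityʳ u = refl

⧢-identityˡ : (u : List A) → [] ⧢ u ≡ word u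
⧢-identityˡ u with reverseView u
... | []         = refl
... | _ ∶ _ ∶ʳ _ = refl

⧢-∷ʳ : (u v : List A) (x y : A) →
  (u ∷ʳ x) ⧢ (v ∷ʳ y) ≡
  q^ (length (v ∷ʳ y)) · (u ⧢ (v ∷ʳ y)) ◃ x ⊕ ((u ∷ʳ x) ⧢ v) ◃ y
⧢-∷ʳ u v x y = trans
  (shuffle-irrelevant (reverseView (u ∷ʳ x)) ux (reverseView (v ∷ʳ y)) vy refl refl)
  (cong₂ (λ s t → q^ (length (v ∷ʳ y)) · s ◃ x ⊕ t ◃ y)
    (shuffle-irrelevant (reverseView u) (reverseView u) vy (reverseView (v ∷ʳ y)) refl refl)
    (shuffle-irrelevant ux (reverseView (u ∷ʳ x)) (reverseView v) (reverseView v) refl refl))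
  where
  ux = u ∶ reverseView u ∶ʳ x
  vy = v ∶ reverseView v ∶ʳ y

-- The symmetric group, enumerated by the position i of the largest value.
-- The two facts after it say that, up to pointwise equality, every
-- permutation is listed exactly once.
𝔖 : (n : ℕ) → List (Permutation′ n)
𝔖 zero    = [ Perm.id ]
𝔖 (suc n) = cartesianProductWith (λ i ρ → insert i (fromℕ n) ρ) (allFin (suc n)) (𝔖 n)

private
  insert-cong : ∀ (i : Fin (suc n)) j {π ρ : Permutation′ n} → π Perm.≈ ρ →
    insert i j π Perm.≈ insert i j ρ
  insert-cong i j π≈ρ k with i Fin.≟ k
  ... | yes _ = refl
  ... | no  _ = cong (Fin.punchIn j) (π≈ρ _)

  insert-at : ∀ (i j : Fin (suc n)) (π : Permutation′ n) → insert i j π ⟨$⟩ʳ i ≡ j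
  insert-at i j π with i Fin.≟ i
  ... | yes _ = refl
  ... | no ¬p = contradiction refl ¬p

  insert-injective : ∀ (i i′ j : Fin (suc n)) (π ρ : Permutation′ n) →
    insert i j π Perm.≈ insert i′ j ρ → i ≡ i′ × π Perm.≈ ρ
  insert-injective i i′ j π ρ eq with
    trans (sym (inverseˡ (insert i′ j ρ) {i}))
      (trans (cong (insert i′ j ρ ⟨$⟩ˡ_)
        (trans (sym (eq i)) (trans (insert-at i j π) (sym (insert-at i′ j ρ)))))
        (inverseˡ (insert i′ j ρ) {i′}))
  ... | refl = refl , λ k → Fin.punchIn-injective j _ _
    (trans (sym (Perm.insert-punchIn i j π k))
      (trans (eq (Fin.punchIn i k)) (Perm.insert-punchIn i j ρ k)))

𝔖-complete : (π : Permutation′ n) → ∃[ ρ ] ρ ∈ 𝔖 n × ρ Perm.≈ π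
𝔖-complete {zero}  π = Perm.id , here refl , λ ()
𝔖-complete {suc n} π with 𝔖-complete (remove (π ⟨$⟩ˡ fromℕ n) π)
... | ρ , ρ∈𝔖 , ρ≈ = insert i (fromℕ n) ρ
                   , ∈-cartesianProductWith⁺ _ (∈-allFin i) ρ∈𝔖
                   , λ k → trans (insert-cong i (fromℕ n) {ρ} {remove i π} ρ≈ k)
                       (subst (λ j → insert i j (remove i π) Perm.≈ π) (inverseʳ π)
                         (insert-remove i π) k)
  where i = π ⟨$⟩ˡ fromℕ n

𝔖-distinct : (n : ℕ) → AllPairs (λ π ρ → ¬ π Perm.≈ ρ) (𝔖 n)
𝔖-distinct zero    = [] ∷ []
𝔖-distinct (suc n) = go (allFin⁺ (suc n))
  where
  go : ∀ {is} → Unique is →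
    AllPairs (λ π ρ → ¬ π Perm.≈ ρ)
      (cartesianProductWith (λ i ρ → insert i (fromℕ n) ρ) is (𝔖 n))
  go [] = []
  go {i ∷ is} (i∉is ∷ uniq) = AllPairs.++⁺
    (AllPairs.map⁺ (AllPairs.map
      (λ {π} {ρ} π≉ρ eq → π≉ρ (proj₂ (insert-injective i i (fromℕ n) π ρ eq)))
      (𝔖-distinct n)))
    (go uniq)
    (All.map⁺ (All.universal (λ π →
      All.cartesianProductWith⁺ (setoid _) (setoid _) _ is (𝔖 n)
        (λ {i′} {ρ} i′∈is _ eq →
          All.lookup i∉is i′∈is (proj₁ (insert-injective i i′ (fromℕ n) π ρ eq))))
      (𝔖 n)))

Inversion : Permutation′ n → Fin n × Fin n → Set
Inversion π (i , j) = i Fin.< j × π ⟨$⟩ʳ j Fin.< π ⟨$⟩ʳ i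

inversion? : (π : Permutation′ n) (ij : Fin n × Fin n) → Dec (Inversion π ij)
inversion? π (i , j) = (i Fin.<? j) ×-dec (π ⟨$⟩ʳ j Fin.<? π ⟨$⟩ʳ i)

inv : Permutation′ n → ℕ
inv {n} π = length (filter (inversion? π) (cartesianProduct (allFin n) (allFin n)))

-- Positions are numbered from 0, so the first k of them are those below k.
IsShuffle : ℕ → Permutation′ n → Set
IsShuffle k π =
  (∀ i j → i Fin.< j → toℕ j ℕ.< k → π ⟨$⟩ʳ i Fin.< π ⟨$⟩ʳ j) ×
  (∀ i j → i Fin.< j → k ℕ.≤ toℕ i → π ⟨$⟩ʳ i Fin.< π ⟨$⟩ʳ j)

isShuffle? : (k : ℕ) (π : Permutation′ n) → Dec (IsShuffle k π)
isShuffle? k π =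
  Fin.all? (λ i → Fin.all? λ j →
    (i Fin.<? j) →-dec ((toℕ j ℕ.<? k) →-dec (π ⟨$⟩ʳ i Fin.<? π ⟨$⟩ʳ j))) ×-dec
  Fin.all? (λ i → Fin.all? λ j →
    (i Fin.<? j) →-dec ((k ℕ.≤? toℕ i) →-dec (π ⟨$⟩ʳ i Fin.<? π ⟨$⟩ʳ j)))

shuffleSum : (k : ℕ) → (Fin n → A) → ℕ[q]⟨ A *⟩
shuffleSum {n} k a =
  concatMap (λ π → q^ inv π · word (tabulate λ i → a (π ⟨$⟩ˡ i)))
            (filter (isShuffle? k) (𝔖 n))

{-# OPTIONS --safe #-}
module Submission where

-- A formal sum s is determined by the values ⟪ s ∣ f ⟫ at s of the linear
-- functionals that send q^i w to f i w.  All operations on formal sums are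
-- adjoint to operations on f, which replaces the algebra of ℕ[q].
--
-- For the formula, remove the largest value n from a permutation π.  If π is
-- increasing on its first k and on its last n − k positions, then n stands at
-- position n, where it contributes no inversions, or at position k < n, where
-- it contributes n − k.  These are the two terms of the recursion for ⧢.
--
-- For associativity, both bracketings of ua, vb, wc satisfy the recursion
--   q^(|vb| + |wc|) (u, vb, wc) a + q^|wc| (ua, v, wc) b + (ua, vb, w) c.

open import Defs
open import Data.Bool using (if_then_else_)
open import Data.Fin as Fin using (Fin; zero; suc; toℕ; fromℕ; fromℕ<; punchIn; punchOut)
import Data.Fin.Properties as Fin
open import Data.Fin.Permutation
  using (Permutation′; _⟨$⟩ʳ_; _⟨$⟩ˡ_; insert; insert-punchIn; inverseˡ; inverseʳ)
open import Data.List
  using (List; []; _∷_; _∷ʳ_; _++_; map; concatMap; filter; length; take; drop; tabulate;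
         allFin; cartesianProduct; cartesianProductWith)
open import Data.List.Properties
  using (≡-dec; length-++; map-++; map-∘; tabulate-cong; length-tabulate; length-drop;
         take-[]; drop-[]; take-all; drop-all; take-suc-tabulate)
open import Data.List.Reverse using (Reverse; []; _∶_∶ʳ_; reverseView)
open import Data.Nat using (ℕ; zero; suc; _+_; _*_; _∸_; _≤_; _<_; z≤n; s≤s; s≤s⁻¹; _≤?_; _≟_)
open import Data.Nat.ListAction using (sum)
open import Data.Nat.ListAction.Properties using (sum-++)
import Data.Nat.Properties as ℕ
open import Data.Nat.Tactic.RingSolver using (solve-∀)
open import Data.Product using (_×_; _,_; proj₁; proj₂; ∃-syntax)
open import Data.Sum using (_⊎_; inj₁; inj₂)
open import Function using (_↔_; _∘_; _⇔_; mk⇔; id; Equivalence)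
open import Level using (Level)
open import Relation.Binary.Definitions using (DecidableEquality)
open import Relation.Binary.PropositionalEquality
  using (_≡_; _≢_; refl; sym; trans; cong; cong₂; subst; module ≡-Reasoning)
open import Relation.Nullary using (Dec; yes; no; does; ¬_; contradiction)
open import Relation.Nullary.Decidable using (does-⇔; dec-false)
open import Relation.Unary using (Pred; Decidable)

open import Algebra.Properties.CommutativeMonoid.Sum ℕ.+-0-commutativeMonoid
  using (sum-remove; sum-cong-≗; sum-replicate-zero) renaming (sum to ∑)

open ≡-Reasoning

private
  variable
    ℓ : Level
    A X Y Z : Set ℓ
    P Q : Set ℓ
    n : ℕ

-- Linear functionals on formal sums

-- Only the truth value of the decision enters, so guards of equivalent propositions agree whatever
-- the decision procedures are.
guard : Dec P → ℕ → ℕ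
guard P? x = if does P? then x else 0

guard-cong : (P? : Dec P) {x y : ℕ} → x ≡ y → guard P? x ≡ guard P? y
guard-cong P? = cong (guard P?)

sumOver : List X → (X → ℕ) → ℕ
sumOver xs f = sum (map f xs)

sumOver-cong : (xs : List X) {f g : X → ℕ} → (∀ x → f x ≡ g x) → sumOver xs f ≡ sumOver xs g
sumOver-cong []       f≗g = refl
sumOver-cong (x ∷ xs) f≗g = cong₂ _+_ (f≗g x) (sumOver-cong xs f≗g)

sumOver-0 : (xs : List X) → sumOver xs (λ _ → 0) ≡ 0
sumOver-0 []       = refl
sumOver-0 (_ ∷ xs) = sumOver-0 xs

sumOver-+ : (xs : List X) (f g : X → ℕ) →
  sumOver xs (λ x → f x + g x) ≡ sumOver xs f + sumOver xs g
sumOver-+ []       f g = refl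
sumOver-+ (x ∷ xs) f g = begin
  (f x + g x) + sumOver xs (λ y → f y + g y)      ≡⟨ cong (f x + g x +_) (sumOver-+ xs f g) ⟩
  (f x + g x) + (sumOver xs f + sumOver xs g)     ≡⟨ +-interchange (f x) (g x) _ _ ⟩
  (f x + sumOver xs f) + (g x + sumOver xs g)     ∎
  where
  +-interchange : ∀ a b c d → (a + b) + (c + d) ≡ (a + c) + (b + d)
  +-interchange = solve-∀

sumOver-* : (xs : List X) (c : ℕ) (f : X → ℕ) →
  sumOver xs (λ x → c * f x) ≡ c * sumOver xs f
sumOver-* []       c f = sym (ℕ.*-zeroʳ c)
sumOver-* (x ∷ xs) c f =
  trans (cong (c * f x +_) (sumOver-* xs c f)) (sym (ℕ.*-distribˡ-+ c (f x) _))

sumOver-++ : (xs ys : List X) (f : X → ℕ) →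
  sumOver (xs ++ ys) f ≡ sumOver xs f + sumOver ys f
sumOver-++ xs ys f = trans (cong sum (map-++ f xs ys)) (sum-++ (map f xs) (map f ys))

sumOver-map : (g : X → Y) (xs : List X) (f : Y → ℕ) → sumOver (map g xs) f ≡ sumOver xs (f ∘ g)
sumOver-map g xs f = cong sum (sym (map-∘ xs))

sumOver-concatMap : (g : X → List Y) (xs : List X) (f : Y → ℕ) →
  sumOver (concatMap g xs) f ≡ sumOver xs (λ x → sumOver (g x) f)
sumOver-concatMap g []       f = refl
sumOver-concatMap g (x ∷ xs) f =
  trans (sumOver-++ (g x) (concatMap g xs) f) (cong (sumOver (g x) f +_) (sumOver-concatMap g xs f))

sumOver-filter : {Q : Pred X ℓ} (Q? : Decidable Q) (xs : List X) (f : X → ℕ) →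
  sumOver (filter Q? xs) f ≡ sumOver xs (λ x → guard (Q? x) (f x))
sumOver-filter Q? []       f = refl
sumOver-filter Q? (x ∷ xs) f with Q? x
... | yes _ = cong (f x +_) (sumOver-filter Q? xs f)
... | no  _ = sumOver-filter Q? xs f

-- Not the value at a point: `f` gives the images of all powers of q independently, so
-- multiplication by q amounts to composing `f` with `suc`.
eval : ℕ[q] → (ℕ → ℕ) → ℕ
eval []      f = 0
eval (c ∷ p) f = c * f 0 + eval p (f ∘ suc)

eval-cong : ∀ p {f g : ℕ → ℕ} → (∀ i → f i ≡ g i) → eval p f ≡ eval p g
eval-cong []      f≗g = refl
eval-cong (c ∷ p) f≗g = cong₂ _+_ (cong (c *_) (f≗g 0)) (eval-cong p (f≗g ∘ suc))

eval-0 : ∀ p → eval p (λ _ → 0) ≡ 0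
eval-0 []      = refl
eval-0 (c ∷ p) = cong₂ _+_ (ℕ.*-zeroʳ c) (eval-0 p)

eval-+ : ∀ p f g → eval p (λ i → f i + g i) ≡ eval p f + eval p g
eval-+ []      f g = refl
eval-+ (c ∷ p) f g = trans (cong (c * (f 0 + g 0) +_) (eval-+ p (f ∘ suc) (g ∘ suc)))
  (rearrange c (f 0) (g 0) _ _)
  where
  rearrange : ∀ c a b d e → c * (a + b) + (d + e) ≡ (c * a + d) + (c * b + e)
  rearrange = solve-∀

eval-* : ∀ p c f → eval p (λ i → c * f i) ≡ c * eval p f
eval-* []      c f = sym (ℕ.*-zeroʳ c)
eval-* (d ∷ p) c f =
  trans (cong (d * (c * f 0) +_) (eval-* p c (f ∘ suc))) (rearrange c d (f 0) _)
  where
  rearrange : ∀ c d a e → d * (c * a) + c * e ≡ c * (d * a + e)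
  rearrange = solve-∀

eval-+ᵖ : ∀ p r f → eval (p +ᵖ r) f ≡ eval p f + eval r f
eval-+ᵖ []      r       f = refl
eval-+ᵖ (c ∷ p) []      f = sym (ℕ.+-identityʳ _)
eval-+ᵖ (c ∷ p) (d ∷ r) f = trans (cong ((c + d) * f 0 +_) (eval-+ᵖ p r (f ∘ suc)))
  (rearrange c d (f 0) _ _)
  where
  rearrange : ∀ c d a e g → (c + d) * a + (e + g) ≡ (c * a + e) + (d * a + g)
  rearrange = solve-∀

eval-map-* : ∀ c r f → eval (map (c *_) r) f ≡ c * eval r f
eval-map-* c []      f = sym (ℕ.*-zeroʳ c)
eval-map-* c (d ∷ r) f = trans (cong (c * d * f 0 +_) (eval-map-* c r (f ∘ suc)))
  (rearrange c d (f 0) _)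
  where
  rearrange : ∀ c d a e → c * d * a + c * e ≡ c * (d * a + e)
  rearrange = solve-∀

-- Exponents add under multiplication, so the product is tested against `f (i + j)` in both factors.
-- The induction peels off the constant coefficient of `p`; the factor q in front of the remainder
-- replaces `f` by `f ∘ suc`.
eval-*ᵖ : ∀ p r f → eval (p *ᵖ r) f ≡ eval r (λ j → eval p (λ i → f (i + j)))
eval-*ᵖ []      r f = sym (eval-0 r)
eval-*ᵖ (c ∷ p) r f = begin
  eval (map (c *_) r +ᵖ (0 ∷ p *ᵖ r)) f
    ≡⟨ eval-+ᵖ (map (c *_) r) _ f ⟩
  eval (map (c *_) r) f + eval (p *ᵖ r) (f ∘ suc)
    ≡⟨ cong₂ _+_ (trans (eval-map-* c r f) (sym (eval-* r c f))) (eval-*ᵖ p r (f ∘ suc)) ⟩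
  eval r (λ j → c * f j) + eval r (λ j → eval p (λ i → f (suc (i + j))))
    ≡⟨ eval-+ r _ _ ⟨
  eval r (λ j → c * f j + eval p (λ i → f (suc (i + j)))) ∎

eval-q^ : ∀ k f → eval (q^ k) f ≡ f k
eval-q^ zero    f = trans (ℕ.+-identityʳ _) (ℕ.*-identityˡ (f 0))
eval-q^ (suc k) f = eval-q^ k (f ∘ suc)

-- The indicator of `i` as a functional; through it, agreement under all functionals implies `_≈ᵖ_`.
coeff-eval : ∀ p i → coeff p i ≡ eval p (λ j → guard (j ≟ i) 1)
coeff-eval []      i       = refl
coeff-eval (c ∷ p) zero    = sym (trans (cong (c * 1 +_) (eval-0 p)) (rearrange c))
  where
  rearrange : ∀ c → c * 1 + 0 ≡ c
  rearrange = solve-∀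
coeff-eval (c ∷ p) (suc i) = trans (coeff-eval p i) (cong (_+ eval p (λ j → guard (j ≟ i) 1)) (sym (ℕ.*-zeroʳ c)))

⟪_∣_⟫ : ℕ[q]⟨ A *⟩ → (ℕ → List A → ℕ) → ℕ
⟪ s ∣ f ⟫ = sumOver s (λ (p , w) → eval p (λ i → f i w))

⟪⟫-cong : (s : ℕ[q]⟨ A *⟩) {f g : ℕ → List A → ℕ} →
  (∀ i w → f i w ≡ g i w) → ⟪ s ∣ f ⟫ ≡ ⟪ s ∣ g ⟫
⟪⟫-cong s f≗g = sumOver-cong s (λ (p , w) → eval-cong p (λ i → f≗g i w))

⟪⟫-0 : (s : ℕ[q]⟨ A *⟩) → ⟪ s ∣ (λ _ _ → 0) ⟫ ≡ 0
⟪⟫-0 s = trans (sumOver-cong s (λ (p , _) → eval-0 p)) (sumOver-0 s)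

⟪⟫-+ : (s : ℕ[q]⟨ A *⟩) (f g : ℕ → List A → ℕ) →
  ⟪ s ∣ (λ i w → f i w + g i w) ⟫ ≡ ⟪ s ∣ f ⟫ + ⟪ s ∣ g ⟫
⟪⟫-+ s f g = trans (sumOver-cong s (λ (p , w) → eval-+ p (λ i → f i w) (λ i → g i w)))
  (sumOver-+ s _ _)

⟪⟫-* : (s : ℕ[q]⟨ A *⟩) (c : ℕ) (f : ℕ → List A → ℕ) →
  ⟪ s ∣ (λ i w → c * f i w) ⟫ ≡ c * ⟪ s ∣ f ⟫
⟪⟫-* s c f = trans (sumOver-cong s (λ (p , w) → eval-* p c (λ i → f i w))) (sumOver-* s c _)

eval-⟪⟫-comm : ∀ p (s : ℕ[q]⟨ A *⟩) (F : ℕ → ℕ → List A → ℕ) →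
  eval p (λ i → ⟪ s ∣ F i ⟫) ≡ ⟪ s ∣ (λ j w → eval p (λ i → F i j w)) ⟫
eval-⟪⟫-comm []      s F = sym (⟪⟫-0 s)
eval-⟪⟫-comm (c ∷ p) s F = begin
  c * ⟪ s ∣ F 0 ⟫ + eval p (λ i → ⟪ s ∣ F (suc i) ⟫)
    ≡⟨ cong₂ _+_ (sym (⟪⟫-* s c (F 0))) (eval-⟪⟫-comm p s (F ∘ suc)) ⟩
  ⟪ s ∣ (λ j w → c * F 0 j w) ⟫ + ⟪ s ∣ (λ j w → eval p (λ i → F (suc i) j w)) ⟫
    ≡⟨ ⟪⟫-+ s _ _ ⟨
  ⟪ s ∣ (λ j w → eval (c ∷ p) (λ i → F i j w)) ⟫ ∎

-- Exchange of finite sums, by which `⟪⧢̂⟫-assoc` moves the sum over the third factor outside the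
-- product of the first two.
⟪⟫-comm : (s t : ℕ[q]⟨ A *⟩) (F : ℕ → List A → ℕ → List A → ℕ) →
  ⟪ s ∣ (λ i u → ⟪ t ∣ F i u ⟫) ⟫ ≡ ⟪ t ∣ (λ j v → ⟪ s ∣ (λ i u → F i u j v) ⟫) ⟫
⟪⟫-comm []            t F = sym (⟪⟫-0 t)
⟪⟫-comm ((p , u) ∷ s) t F =
  trans (cong₂ _+_ (eval-⟪⟫-comm p t (λ i → F i u)) (⟪⟫-comm s t F)) (sym (⟪⟫-+ t _ _))

⟪word⟫ : (w : List A) (f : ℕ → List A → ℕ) → ⟪ word w ∣ f ⟫ ≡ f 0 w
⟪word⟫ w f = trans (ℕ.+-identityʳ _) (eval-q^ 0 (λ i → f i w))

⟪·⟫ : ∀ p (s : ℕ[q]⟨ A *⟩) (f : ℕ → List A → ℕ) →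
  ⟪ p · s ∣ f ⟫ ≡ eval p (λ i → ⟪ s ∣ (λ j → f (i + j)) ⟫)
⟪·⟫ p s f = begin
  ⟪ p · s ∣ f ⟫
    ≡⟨ sumOver-map _ s _ ⟩
  sumOver s (λ (r , w) → eval (p *ᵖ r) (λ i → f i w))
    ≡⟨ sumOver-cong s (λ (r , w) → eval-*ᵖ p r (λ i → f i w)) ⟩
  ⟪ s ∣ (λ j w → eval p (λ i → f (i + j) w)) ⟫
    ≡⟨ eval-⟪⟫-comm p s (λ i j → f (i + j)) ⟨
  eval p (λ i → ⟪ s ∣ (λ j → f (i + j)) ⟫) ∎

⟪q^·⟫ : ∀ k (s : ℕ[q]⟨ A *⟩) (f : ℕ → List A → ℕ) →
  ⟪ q^ k · s ∣ f ⟫ ≡ ⟪ s ∣ (λ j → f (k + j)) ⟫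
⟪q^·⟫ k s f = trans (⟪·⟫ (q^ k) s f) (eval-q^ k _)

⟪◃⟫ : (s : ℕ[q]⟨ A *⟩) (x : A) (f : ℕ → List A → ℕ) →
  ⟪ s ◃ x ∣ f ⟫ ≡ ⟪ s ∣ (λ i w → f i (w ∷ʳ x)) ⟫
⟪◃⟫ s x f = sumOver-map _ s _

coefficient-⟪⟫ : (_≟ᴬ_ : DecidableEquality A) (s : ℕ[q]⟨ A *⟩) (w : List A) (i : ℕ) →
  coeff (coefficient _≟ᴬ_ s w) i ≡
  ⟪ s ∣ (λ j u → guard (≡-dec _≟ᴬ_ u w) (guard (j ≟ i) 1)) ⟫
coefficient-⟪⟫ _≟ᴬ_ s w i = trans (coeff-eval (coefficient _≟ᴬ_ s w) i) (go s)
  where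
  go : ∀ s → eval (coefficient _≟ᴬ_ s w) (λ j → guard (j ≟ i) 1) ≡
             ⟪ s ∣ (λ j u → guard (≡-dec _≟ᴬ_ u w) (guard (j ≟ i) 1)) ⟫
  go []            = refl
  go ((p , u) ∷ s) with ≡-dec _≟ᴬ_ u w
  ... | yes _ = trans (eval-+ᵖ p (coefficient _≟ᴬ_ s w) _) (cong (eval p _ +_) (go s))
  ... | no  _ = trans (go s) (cong (_+ ⟪ s ∣ _ ⟫) (sym (eval-0 p)))

-- By `coefficient-⟪⟫`, each coefficient of each word is a functional, namely the joint indicator of
-- the word and the exponent. From here on it suffices to compare functionals, and no equal words
-- have to be collected.
⟪⟫-≈ : ∀ {m} (finite : A ↔ Fin m) (s t : ℕ[q]⟨ A *⟩) →
  (∀ f → ⟪ s ∣ f ⟫ ≡ ⟪ t ∣ f ⟫) → s ≈[ finite ] t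
⟪⟫-≈ finite s t s≡t w i =
  trans (coefficient-⟪⟫ _ s w i) (trans (s≡t _) (sym (coefficient-⟪⟫ _ t w i)))

-- Bilinearity: the exponents `i` and `j` of two terms and the exponent `k` from the shuffle of
-- their words add up.
⟪⧢̂⟫ : (s t : ℕ[q]⟨ A *⟩) (f : ℕ → List A → ℕ) →
  ⟪ s ⧢̂ t ∣ f ⟫ ≡
  ⟪ s ∣ (λ i u → ⟪ t ∣ (λ j v → ⟪ u ⧢ v ∣ (λ k → f (i + j + k)) ⟫) ⟫) ⟫
⟪⧢̂⟫ s t f = trans (sumOver-concatMap _ s _) (sumOver-cong s λ (p , u) → begin
  ⟪ concatMap (λ (r , v) → (p *ᵖ r) · (u ⧢ v)) t ∣ f ⟫
    ≡⟨ sumOver-concatMap _ t _ ⟩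
  sumOver t (λ (r , v) → ⟪ (p *ᵖ r) · (u ⧢ v) ∣ f ⟫)
    ≡⟨ sumOver-cong t (λ (r , v) → trans (⟪·⟫ (p *ᵖ r) (u ⧢ v) f) (eval-*ᵖ p r _)) ⟩
  ⟪ t ∣ (λ j v → eval p (λ i → ⟪ u ⧢ v ∣ (λ k → f (i + j + k)) ⟫)) ⟫
    ≡⟨ eval-⟪⟫-comm p t _ ⟨
  eval p (λ i → ⟪ t ∣ (λ j v → ⟪ u ⧢ v ∣ (λ k → f (i + j + k)) ⟫) ⟫) ∎)

-- The q-shuffle of two words under functionals

⟪⧢-[]⟫ : (u : List A) (f : ℕ → List A → ℕ) → ⟪ u ⧢ [] ∣ f ⟫ ≡ f 0 u
⟪⧢-[]⟫ = ⟪word⟫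

⟪[]-⧢⟫ : (u : List A) (f : ℕ → List A → ℕ) → ⟪ [] ⧢ u ∣ f ⟫ ≡ f 0 u
⟪[]-⧢⟫ u f = trans (cong ⟪_∣ f ⟫ (⧢-identityˡ u)) (⟪word⟫ u f)

-- Under a functional the factor `q^ (length (v ∷ʳ y))` shifts the exponent, and the last letter is
-- appended inside the argument.
⟪⧢-∷ʳ⟫ : (u v : List A) (x y : A) (f : ℕ → List A → ℕ) →
  ⟪ (u ∷ʳ x) ⧢ (v ∷ʳ y) ∣ f ⟫ ≡
  ⟪ u ⧢ (v ∷ʳ y) ∣ (λ i z → f (length (v ∷ʳ y) + i) (z ∷ʳ x)) ⟫ +
  ⟪ (u ∷ʳ x) ⧢ v ∣ (λ i z → f i (z ∷ʳ y)) ⟫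
⟪⧢-∷ʳ⟫ u v x y f = begin
  ⟪ (u ∷ʳ x) ⧢ (v ∷ʳ y) ∣ f ⟫
    ≡⟨ cong ⟪_∣ f ⟫ (⧢-∷ʳ u v x y) ⟩
  ⟪ q^ (length (v ∷ʳ y)) · (u ⧢ (v ∷ʳ y)) ◃ x ⊕ ((u ∷ʳ x) ⧢ v) ◃ y ∣ f ⟫
    ≡⟨ sumOver-++ (q^ (length (v ∷ʳ y)) · (u ⧢ (v ∷ʳ y)) ◃ x) (((u ∷ʳ x) ⧢ v) ◃ y) _ ⟩
  ⟪ q^ (length (v ∷ʳ y)) · (u ⧢ (v ∷ʳ y)) ◃ x ∣ f ⟫ + ⟪ ((u ∷ʳ x) ⧢ v) ◃ y ∣ f ⟫
    ≡⟨ cong₂ _+_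
         (trans (⟪q^·⟫ (length (v ∷ʳ y)) ((u ⧢ (v ∷ʳ y)) ◃ x) f) (⟪◃⟫ (u ⧢ (v ∷ʳ y)) x _))
         (⟪◃⟫ ((u ∷ʳ x) ⧢ v) y f) ⟩
  _ ∎

-- Associativity of the q-shuffle

length-∷ʳ : (u : List A) (x : A) → length (u ∷ʳ x) ≡ suc (length u)
length-∷ʳ u x = trans (length-++ u) (ℕ.+-comm (length u) 1)

-- Each step of the recursion appends one letter, so only words of length `length u + length v`
-- occur. In this form the fact can be used under a functional whose exponent depends on the length
-- of the word.
⟪⧢⟫-cong-length : (u v : List A) {f g : ℕ → List A → ℕ} →
  (∀ i w → length w ≡ length u + length v → f i w ≡ g i w) →
  ⟪ u ⧢ v ∣ f ⟫ ≡ ⟪ u ⧢ v ∣ g ⟫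
⟪⧢⟫-cong-length u v = go (reverseView u) (reverseView v)
  where
  go : ∀ {u v} → Reverse u → Reverse v → ∀ {f g} →
    (∀ i w → length w ≡ length u + length v → f i w ≡ g i w) →
    ⟪ u ⧢ v ∣ f ⟫ ≡ ⟪ u ⧢ v ∣ g ⟫
  go {u} _ [] {f} {g} f≗g =
    trans (⟪⧢-[]⟫ u f) (trans (f≗g 0 u (sym (ℕ.+-identityʳ _))) (sym (⟪⧢-[]⟫ u g)))
  go {v = v} [] (_ ∶ _ ∶ʳ _) {f} {g} f≗g =
    trans (⟪[]-⧢⟫ v f) (trans (f≗g 0 v refl) (sym (⟪[]-⧢⟫ v g)))
  go (u ∶ ru ∶ʳ x) (v ∶ rv ∶ʳ y) {f} {g} f≗g = begin
    ⟪ (u ∷ʳ x) ⧢ (v ∷ʳ y) ∣ f ⟫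
      ≡⟨ ⟪⧢-∷ʳ⟫ u v x y f ⟩
    _
      ≡⟨ cong₂ _+_
           (go ru (v ∶ rv ∶ʳ y) (λ i w eq → f≗g _ (w ∷ʳ x)
             (trans (length-∷ʳ w x)
               (trans (cong suc eq) (cong (_+ length (v ∷ʳ y)) (sym (length-∷ʳ u x)))))))
           (go (u ∶ ru ∶ʳ x) rv (λ i w eq → f≗g i (w ∷ʳ y)
             (trans (length-∷ʳ w y)
               (trans (cong suc eq) (trans (sym (ℕ.+-suc (length (u ∷ʳ x)) (length v)))
                 (cong (length (u ∷ʳ x) +_) (sym (length-∷ʳ v y)))))))) ⟩
    _
      ≡⟨ ⟪⧢-∷ʳ⟫ u v x y g ⟨
    ⟪ (u ∷ʳ x) ⧢ (v ∷ʳ y) ∣ g ⟫ ∎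

-- On the right, splitting off the last letter of u costs q to the power of the
-- length of a word of v ⧢ w, which is constant.
⟪⧢⟫-assoc : (u v w : List A) (f : ℕ → List A → ℕ) →
  ⟪ u ⧢ v ∣ (λ i x → ⟪ x ⧢ w ∣ (λ j → f (i + j)) ⟫) ⟫ ≡
  ⟪ v ⧢ w ∣ (λ i x → ⟪ u ⧢ x ∣ (λ j → f (i + j)) ⟫) ⟫
⟪⧢⟫-assoc u v w = go (reverseView u) (reverseView v) (reverseView w)
  where
  go : ∀ {u v w} → Reverse u → Reverse v → Reverse w → ∀ f →
    ⟪ u ⧢ v ∣ (λ i x → ⟪ x ⧢ w ∣ (λ j → f (i + j)) ⟫) ⟫ ≡
    ⟪ v ⧢ w ∣ (λ i x → ⟪ u ⧢ x ∣ (λ j → f (i + j)) ⟫) ⟫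
  go {v = v} {w} [] _ _ f = trans (⟪[]-⧢⟫ v _) (⟪⟫-cong (v ⧢ w) (λ i x →
    sym (trans (⟪[]-⧢⟫ x (λ j → f (i + j))) (cong (λ k → f k x) (ℕ.+-identityʳ i)))))
  go {u} {w = w} (_ ∶ _ ∶ʳ _) [] _ f = trans
    (⟪⧢-[]⟫ u (λ i x → ⟪ x ⧢ w ∣ (λ j → f (i + j)) ⟫))
    (sym (⟪[]-⧢⟫ w (λ i x → ⟪ u ⧢ x ∣ (λ j → f (i + j)) ⟫)))
  go {u} {v} (_ ∶ _ ∶ʳ _) (_ ∶ _ ∶ʳ _) [] f = trans
    (⟪⟫-cong (u ⧢ v) (λ i x →
      trans (⟪⧢-[]⟫ x (λ j → f (i + j))) (cong (λ k → f k x) (ℕ.+-identityʳ i))))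
    (sym (⟪⧢-[]⟫ v (λ i x → ⟪ u ⧢ x ∣ (λ j → f (i + j)) ⟫)))
  go ru′@(u ∶ ru ∶ʳ a) rv′@(v ∶ rv ∶ʳ b) rw′@(w ∶ rw ∶ʳ c) f = begin
    ⟪ ua ⧢ vb ∣ (λ i x → ⟪ x ⧢ wc ∣ (λ j → f (i + j)) ⟫) ⟫
      ≡⟨ ⟪⧢-∷ʳ⟫ u v a b _ ⟩
    ⟪ u ⧢ vb ∣ (λ i x → ⟪ (x ∷ʳ a) ⧢ wc ∣ (λ j → f (length vb + i + j)) ⟫) ⟫ +
    ⟪ ua ⧢ v ∣ (λ i x → ⟪ (x ∷ʳ b) ⧢ wc ∣ (λ j → f (i + j)) ⟫) ⟫
      ≡⟨ cong₂ _+_ (trans (⟪⟫-cong (u ⧢ vb) (λ i x → ⟪⧢-∷ʳ⟫ x w a c _)) (⟪⟫-+ (u ⧢ vb) _ _))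
                   (trans (⟪⟫-cong (ua ⧢ v) (λ i x → ⟪⧢-∷ʳ⟫ x w b c _)) (⟪⟫-+ (ua ⧢ v) _ _)) ⟩
    (l₁ + l₂) + (l₃ + l₄)
      -- `l₂` and `l₄`, the terms ending in `c`, are together the recursion for `ua ⧢ vb`, followed
      -- by a shuffle with `w`.
      ≡⟨ middle-last l₁ l₂ l₃ l₄ ⟩
    l₁ + (l₃ + (l₂ + l₄))
      ≡⟨ cong₂ _+_
           (⟪⟫-cong (u ⧢ vb) (λ i x → ⟪⟫-cong (x ⧢ wc) (λ j z →
             cong (λ k → f k (z ∷ʳ a)) (shift₁ (length vb) (length wc) i j))))
           (cong₂ _+_
             (⟪⟫-cong (ua ⧢ v) (λ i x → ⟪⟫-cong (x ⧢ wc) (λ j z →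
               cong (λ k → f k (z ∷ʳ b)) (shift₂ (length wc) i j))))
             (sym (⟪⧢-∷ʳ⟫ u v a b _))) ⟩
    ⟪ u ⧢ vb ∣ (λ i x → ⟪ x ⧢ wc ∣ (λ j → fᵃ (i + j)) ⟫) ⟫ +
    (⟪ ua ⧢ v ∣ (λ i x → ⟪ x ⧢ wc ∣ (λ j → fᵇ (i + j)) ⟫) ⟫ +
     ⟪ ua ⧢ vb ∣ (λ i x → ⟪ x ⧢ w ∣ (λ j → fᶜ (i + j)) ⟫) ⟫)
      ≡⟨ cong₂ _+_ (go ru rv′ rw′ fᵃ) (cong₂ _+_ (go ru′ rv rw′ fᵇ) (go ru′ rv′ rw fᶜ)) ⟩
    ⟪ vb ⧢ wc ∣ (λ i x → ⟪ u ⧢ x ∣ (λ j → fᵃ (i + j)) ⟫) ⟫ + (r₃ + r₄)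
      ≡⟨ cong (_+ (r₃ + r₄)) (⟪⧢-∷ʳ⟫ v w b c _) ⟩
    (r₁ + r₂) + (r₃ + r₄)
      -- For words `x` of `v ⧢ wc`, `r₁` and `r₃` are the two terms of the recursion for
      -- `ua ⧢ (x ∷ʳ b)`; likewise `r₂` and `r₄` for `ua ⧢ (x ∷ʳ c)` with `x` from `vb ⧢ w`.
      ≡⟨ interchange r₁ r₂ r₃ r₄ ⟩
    (r₁ + r₃) + (r₂ + r₄)
      ≡⟨ cong₂ _+_
           (trans (sym (⟪⟫-+ (v ⧢ wc) _ _)) (⟪⧢⟫-cong-length v wc λ i x |x| →
             sym (trans (⟪⧢-∷ʳ⟫ u x a b _) (cong₂ _+_
               (⟪⟫-cong (u ⧢ (x ∷ʳ b)) (λ j z → cong (λ k → f k (z ∷ʳ a))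
                 (trans (cong (λ l → length wc + i + (l + j)) (length-xb x |x|))
                   (shift₂ L (length wc + i) j))))
               (⟪⟫-cong (ua ⧢ x) (λ j z →
                 cong (λ k → f k (z ∷ʳ b)) (ℕ.+-assoc (length wc) i j)))))))
           (trans (sym (⟪⟫-+ (vb ⧢ w) _ _)) (⟪⧢⟫-cong-length vb w λ i x |x| →
             sym (trans (⟪⧢-∷ʳ⟫ u x a c _) (cong (_+ ⟪ ua ⧢ x ∣ (λ j → fᶜ (i + j)) ⟫)
               (⟪⟫-cong (u ⧢ (x ∷ʳ c)) (λ j z → cong (λ k → f k (z ∷ʳ a))
                 (trans (cong (λ l → i + (l + j)) (length-xc x |x|))
                   (shift₂ L i j)))))))) ⟩
    ⟪ v ⧢ wc ∣ (λ i x → ⟪ ua ⧢ (x ∷ʳ b) ∣ (λ j → f (length wc + i + j)) ⟫) ⟫ +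
    ⟪ vb ⧢ w ∣ (λ i x → ⟪ ua ⧢ (x ∷ʳ c) ∣ (λ j → f (i + j)) ⟫) ⟫
      ≡⟨ ⟪⧢-∷ʳ⟫ v w b c _ ⟨
    ⟪ vb ⧢ wc ∣ (λ i x → ⟪ ua ⧢ x ∣ (λ j → f (i + j)) ⟫) ⟫ ∎
    where
    ua = u ∷ʳ a
    vb = v ∷ʳ b
    wc = w ∷ʳ c
    L = length vb + length wc
    -- The three terms of the symmetric recursion, by their last letter, with the powers of q built
    -- in.
    fᵃ fᵇ fᶜ : ℕ → List _ → ℕ
    fᵃ i z = f (L + i) (z ∷ʳ a)
    fᵇ i z = f (length wc + i) (z ∷ʳ b)
    fᶜ i z = f i (z ∷ʳ c)
    l₁ = ⟪ u ⧢ vb ∣ (λ i x → ⟪ x ⧢ wc ∣ (λ j z → f (length vb + i + (length wc + j)) (z ∷ʳ a)) ⟫) ⟫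
    l₂ = ⟪ u ⧢ vb ∣ (λ i x → ⟪ (x ∷ʳ a) ⧢ w ∣ (λ j z → f (length vb + i + j) (z ∷ʳ c)) ⟫) ⟫
    l₃ = ⟪ ua ⧢ v ∣ (λ i x → ⟪ x ⧢ wc ∣ (λ j z → f (i + (length wc + j)) (z ∷ʳ b)) ⟫) ⟫
    l₄ = ⟪ ua ⧢ v ∣ (λ i x → ⟪ (x ∷ʳ b) ⧢ w ∣ (λ j z → f (i + j) (z ∷ʳ c)) ⟫) ⟫
    r₁ = ⟪ v ⧢ wc ∣ (λ i x → ⟪ u ⧢ (x ∷ʳ b) ∣ (λ j → fᵃ (length wc + i + j)) ⟫) ⟫
    r₂ = ⟪ vb ⧢ w ∣ (λ i x → ⟪ u ⧢ (x ∷ʳ c) ∣ (λ j → fᵃ (i + j)) ⟫) ⟫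
    r₃ = ⟪ v ⧢ wc ∣ (λ i x → ⟪ ua ⧢ x ∣ (λ j → fᵇ (i + j)) ⟫) ⟫
    r₄ = ⟪ vb ⧢ w ∣ (λ i x → ⟪ ua ⧢ x ∣ (λ j → fᶜ (i + j)) ⟫) ⟫
    middle-last : ∀ p q r s → (p + q) + (r + s) ≡ p + (r + (q + s))
    middle-last = solve-∀
    interchange : ∀ p q r s → (p + q) + (r + s) ≡ (p + r) + (q + s)
    interchange = solve-∀
    shift₁ : ∀ l m i j → l + i + (m + j) ≡ l + m + (i + j)
    shift₁ = solve-∀
    shift₂ : ∀ m i j → i + (m + j) ≡ m + (i + j)
    shift₂ = solve-∀
    length-xb : ∀ x → length x ≡ length v + length wc → length (x ∷ʳ b) ≡ L
    length-xb x |x| = trans (length-∷ʳ x b)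
      (trans (cong suc |x|) (cong (_+ length wc) (sym (length-∷ʳ v b))))
    length-xc : ∀ x → length x ≡ length vb + length w → length (x ∷ʳ c) ≡ L
    length-xc x |x| = trans (length-∷ʳ x c)
      (trans (cong suc |x|) (trans (sym (ℕ.+-suc (length vb) (length w)))
        (cong (length vb +_) (sym (length-∷ʳ w c)))))

-- Both sides expand by `⟪⧢̂⟫` into sums over triples of terms. For each triple `⟪⧢⟫-assoc` applies
-- to the three words, with the functional shifted by the exponents of the three coefficients.
⟪⧢̂⟫-assoc : (s t r : ℕ[q]⟨ A *⟩) (f : ℕ → List A → ℕ) →
  ⟪ (s ⧢̂ t) ⧢̂ r ∣ f ⟫ ≡ ⟪ s ⧢̂ (t ⧢̂ r) ∣ f ⟫
⟪⧢̂⟫-assoc s t r f = begin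
  ⟪ (s ⧢̂ t) ⧢̂ r ∣ f ⟫
    ≡⟨ trans (⟪⧢̂⟫ (s ⧢̂ t) r f) (⟪⧢̂⟫ s t _) ⟩
  ⟪ s ∣ (λ i u → ⟪ t ∣ (λ j v → ⟪ u ⧢ v ∣ (λ k x →
    ⟪ r ∣ (λ l w → ⟪ x ⧢ w ∣ (λ h → f (i + j + k + l + h)) ⟫) ⟫) ⟫) ⟫) ⟫
    ≡⟨ ⟪⟫-cong s (λ i u → ⟪⟫-cong t (λ j v → begin
         ⟪ u ⧢ v ∣ (λ k x → ⟪ r ∣ (λ l w → ⟪ x ⧢ w ∣ (λ h → f (i + j + k + l + h)) ⟫) ⟫) ⟫
           ≡⟨ ⟪⟫-comm (u ⧢ v) r _ ⟩
         ⟪ r ∣ (λ l w → ⟪ u ⧢ v ∣ (λ k x → ⟪ x ⧢ w ∣ (λ h → f (i + j + k + l + h)) ⟫) ⟫) ⟫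
           ≡⟨ ⟪⟫-cong r (λ l w → begin
                ⟪ u ⧢ v ∣ (λ k x → ⟪ x ⧢ w ∣ (λ h → f (i + j + k + l + h)) ⟫) ⟫
                  ≡⟨ ⟪⟫-cong (u ⧢ v) (λ k x → ⟪⟫-cong (x ⧢ w) (λ h z →
                       cong (λ m → f m z) (shift₁ i j k l h))) ⟩
                ⟪ u ⧢ v ∣ (λ k x → ⟪ x ⧢ w ∣ (λ h → f (i + (j + l) + (k + h))) ⟫) ⟫
                  ≡⟨ ⟪⧢⟫-assoc u v w (λ k → f (i + (j + l) + k)) ⟩
                ⟪ v ⧢ w ∣ (λ k x → ⟪ u ⧢ x ∣ (λ h → f (i + (j + l) + (k + h))) ⟫) ⟫
                  ≡⟨ ⟪⟫-cong (v ⧢ w) (λ k x → ⟪⟫-cong (u ⧢ x) (λ h z →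
                       cong (λ m → f m z) (shift₂ i j k l h))) ⟩
                ⟪ v ⧢ w ∣ (λ k x → ⟪ u ⧢ x ∣ (λ h → f (i + (j + l + k) + h)) ⟫) ⟫ ∎) ⟩
         ⟪ r ∣ (λ l w → ⟪ v ⧢ w ∣ (λ k x → ⟪ u ⧢ x ∣
           (λ h → f (i + (j + l + k) + h)) ⟫) ⟫) ⟫ ∎)) ⟩
  ⟪ s ∣ (λ i u → ⟪ t ∣ (λ j v → ⟪ r ∣ (λ l w → ⟪ v ⧢ w ∣ (λ k x →
    ⟪ u ⧢ x ∣ (λ h → f (i + (j + l + k) + h)) ⟫) ⟫) ⟫) ⟫) ⟫
    ≡⟨ trans (⟪⧢̂⟫ s (t ⧢̂ r) f) (⟪⟫-cong s (λ i u → ⟪⧢̂⟫ t r _)) ⟨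
  ⟪ s ⧢̂ (t ⧢̂ r) ∣ f ⟫ ∎
  where
  shift₁ : ∀ i j k l h → i + j + k + l + h ≡ i + (j + l) + (k + h)
  shift₁ = solve-∀
  shift₂ : ∀ i j k l h → i + (j + l) + (k + h) ≡ i + (j + l + k) + h
  shift₂ = solve-∀

-- Removing the largest value of a permutation

guard-⇔ : P ⇔ Q → (P? : Dec P) (Q? : Dec Q) (x : ℕ) → guard P? x ≡ guard Q? x
guard-⇔ P⇔Q P? Q? x = cong (if_then x else 0) (does-⇔ P⇔Q P? Q?)

guard-¬ : (P? : Dec P) {x : ℕ} → ¬ P → guard P? x ≡ 0
guard-¬ P? {x} ¬p = cong (if_then x else 0) (dec-false P? ¬p)

-- Sums over finite index sets

∑-0 : {f : Fin n → ℕ} → (∀ i → f i ≡ 0) → ∑ f ≡ 0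
∑-0 {n} f≗0 = trans (sum-cong-≗ f≗0) (sum-replicate-zero n)

∑-single : (f : Fin (suc n) → ℕ) (i : Fin (suc n)) → (∀ j → j ≢ i → f j ≡ 0) → ∑ f ≡ f i
∑-single f i f≡0 = begin
  ∑ f                     ≡⟨ sum-remove {i = i} f ⟩
  f i + ∑ (f ∘ punchIn i) ≡⟨ cong (f i +_) (∑-0 (λ j → f≡0 _ (Fin.punchInᵢ≢i i j))) ⟩
  f i + 0                 ≡⟨ ℕ.+-identityʳ (f i) ⟩
  f i                     ∎

∑-pair : (f : Fin (suc n) → ℕ) {i j : Fin (suc n)} → i ≢ j →
  (∀ l → l ≢ i → l ≢ j → f l ≡ 0) → ∑ f ≡ f i + f j
-- After `i` is removed, `∑-single` needs an index set that is still nonempty, hence the separate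
-- case of a single index.
∑-pair {zero}  f {zero} {zero} i≢j f≡0 = contradiction refl i≢j
∑-pair {suc n} f {i}    {j}    i≢j f≡0 = begin
  ∑ f
    ≡⟨ sum-remove {i = i} f ⟩
  f i + ∑ (f ∘ punchIn i)
    ≡⟨ cong (f i +_) (∑-single (f ∘ punchIn i) (punchOut i≢j) (λ l l≢ →
         f≡0 _ (Fin.punchInᵢ≢i i l) (λ eq → l≢
           (Fin.punchIn-injective i _ _ (trans eq (sym (Fin.punchIn-punchOut i≢j))))))) ⟩
  f i + f (punchIn i (punchOut i≢j))
    ≡⟨ cong (λ l → f i + f l) (Fin.punchIn-punchOut i≢j) ⟩
  f i + f j ∎

sumOver-tabulate : (g : Fin n → X) (f : X → ℕ) → sumOver (tabulate g) f ≡ ∑ (f ∘ g)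
sumOver-tabulate {zero}  g f = refl
sumOver-tabulate {suc n} g f = cong (f (g zero) +_) (sumOver-tabulate (g ∘ suc) f)

sumOver-cartesianProductWith : (h : X → Y → Z) (xs : List X) (ys : List Y) (f : Z → ℕ) →
  sumOver (cartesianProductWith h xs ys) f ≡ sumOver xs (λ x → sumOver ys (λ y → f (h x y)))
sumOver-cartesianProductWith h []       ys f = refl
sumOver-cartesianProductWith h (x ∷ xs) ys f =
  trans (sumOver-++ (map (h x) ys) (cartesianProductWith h xs ys) f)
    (cong₂ _+_ (sumOver-map (h x) ys f) (sumOver-cartesianProductWith h xs ys f))

length-sumOver : (xs : List X) → length xs ≡ sumOver xs (λ _ → 1)
length-sumOver []       = refl
length-sumOver (_ ∷ xs) = cong suc (length-sumOver xs)

-- Deleting an index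

punchIn-view : (i j : Fin (suc n)) → j ≡ i ⊎ ∃[ k ] j ≡ punchIn i k
punchIn-view i j with i Fin.≟ j
... | yes i≡j = inj₁ (sym i≡j)
... | no  i≢j = inj₂ (punchOut i≢j , sym (Fin.punchIn-punchOut i≢j))

punchIn-mono-< : (i : Fin (suc n)) {j k : Fin n} → j Fin.< k → punchIn i j Fin.< punchIn i k
punchIn-mono-< i j<k = ℕ.≰⇒> (ℕ.<⇒≱ j<k ∘ Fin.punchIn-cancel-≤ i _ _)

punchIn-cancel-< : (i : Fin (suc n)) {j k : Fin n} → punchIn i j Fin.< punchIn i k → j Fin.< k
punchIn-cancel-< i i< = ℕ.≰⇒> (ℕ.<⇒≱ i< ∘ Fin.punchIn-mono-≤ i _ _)

toℕ-punchIn-< : (i : Fin (suc n)) (j : Fin n) → toℕ j < toℕ i → toℕ (punchIn i j) ≡ toℕ j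
toℕ-punchIn-< (suc i) zero    _         = refl
toℕ-punchIn-< (suc i) (suc j) (s≤s j<i) = cong suc (toℕ-punchIn-< i j j<i)

toℕ-punchIn-≥ : (i : Fin (suc n)) (j : Fin n) → toℕ i ≤ toℕ j → toℕ (punchIn i j) ≡ suc (toℕ j)
toℕ-punchIn-≥ zero    j       _         = refl
toℕ-punchIn-≥ (suc i) (suc j) (s≤s i≤j) = cong suc (toℕ-punchIn-≥ i j i≤j)

toℕ-punchIn-fromℕ : (j : Fin n) → toℕ (punchIn (fromℕ n) j) ≡ toℕ j
toℕ-punchIn-fromℕ {n} j =
  toℕ-punchIn-< (fromℕ n) j (subst (toℕ j <_) (sym (Fin.toℕ-fromℕ n)) (Fin.toℕ<n j))

<-punchIn⇔≤ : (i : Fin (suc n)) (j : Fin n) → i Fin.< punchIn i j ⇔ toℕ i ≤ toℕ j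
<-punchIn⇔≤ i j = mk⇔
  (λ i<ij → ℕ.≮⇒≥ (λ j<i → ℕ.<-asym j<i (subst (toℕ i <_) (toℕ-punchIn-< i j j<i) i<ij)))
  (λ i≤j → subst (toℕ i <_) (sym (toℕ-punchIn-≥ i j i≤j)) (s≤s i≤j))

-- With `i` as the last position of a first block of size `suc (toℕ i)`, its deletion shortens that
-- block by one.
punchIn-<-suc⇔< : (i : Fin (suc n)) (j : Fin n) → toℕ (punchIn i j) < suc (toℕ i) ⇔ toℕ j < toℕ i
punchIn-<-suc⇔< i j = mk⇔
  (λ { (s≤s ij≤i) → ℕ.≰⇒> (λ i≤j → ℕ.<⇒≱ (Equivalence.from (<-punchIn⇔≤ i j) i≤j) ij≤i) })
  (λ j<i → s≤s (subst (_≤ toℕ i) (sym (toℕ-punchIn-< i j j<i)) (ℕ.<⇒≤ j<i)))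

punchIn-fromℕ-< : (j : Fin n) → punchIn (fromℕ n) j Fin.< fromℕ n
punchIn-fromℕ-< {n} j = Fin.≤∧≢⇒< (Fin.≤fromℕ _) (Fin.punchInᵢ≢i (fromℕ n) j)

-- `punchIn (fromℕ n)` is the inclusion of the first `n` indices, so that deletion of the last
-- letter has the same form as deletion of the letter at `i`.
tabulate-∷ʳ : (a : Fin (suc n) → A) →
  tabulate a ≡ tabulate (a ∘ punchIn (fromℕ n)) ∷ʳ a (fromℕ n)
tabulate-∷ʳ {zero}  a = refl
tabulate-∷ʳ {suc n} a = cong (a zero ∷_) (tabulate-∷ʳ (a ∘ suc))

take-tabulate-punchIn : (a : Fin (suc n) → A) (i : Fin (suc n)) →
  take (toℕ i) (tabulate (a ∘ punchIn i)) ≡ take (toℕ i) (tabulate a)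
take-tabulate-punchIn         a zero    = refl
take-tabulate-punchIn {suc n} a (suc i) = cong (a zero ∷_) (take-tabulate-punchIn (a ∘ suc) i)

drop-tabulate-punchIn : (a : Fin (suc n) → A) (i : Fin (suc n)) →
  drop (toℕ i) (tabulate (a ∘ punchIn i)) ≡ drop (suc (toℕ i)) (tabulate a)
drop-tabulate-punchIn         a zero    = refl
drop-tabulate-punchIn {suc n} a (suc i) = drop-tabulate-punchIn (a ∘ suc) i

take-++-≤ : ∀ k (xs ys : List A) → k ≤ length xs → take k (xs ++ ys) ≡ take k xs
take-++-≤ zero    xs       ys _         = refl
take-++-≤ (suc k) (x ∷ xs) ys (s≤s k≤n) = cong (x ∷_) (take-++-≤ k xs ys k≤n)

drop-++-≤ : ∀ k (xs ys : List A) → k ≤ length xs → drop k (xs ++ ys) ≡ drop k xs ++ ys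
drop-++-≤ zero    xs       ys _         = refl
drop-++-≤ (suc k) (x ∷ xs) ys (s≤s k≤n) = drop-++-≤ k xs ys k≤n

-- Inserting a largest value

insert-at : (i j : Fin (suc n)) (π : Permutation′ n) → insert i j π ⟨$⟩ʳ i ≡ j
insert-at i j π with i Fin.≟ i
... | yes _   = refl
... | no  i≢i = contradiction refl i≢i

insert-at⁻¹ : (i j : Fin (suc n)) (π : Permutation′ n) → insert i j π ⟨$⟩ˡ j ≡ i
insert-at⁻¹ i j π =
  trans (cong (insert i j π ⟨$⟩ˡ_) (sym (insert-at i j π))) (inverseˡ (insert i j π))

-- Follows from `insert-punchIn` at the position `π ⟨$⟩ˡ k`, where `π` has the value `k`.
insert-punchIn⁻¹ : (i j : Fin (suc n)) (π : Permutation′ n) (k : Fin n) →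
  insert i j π ⟨$⟩ˡ punchIn j k ≡ punchIn i (π ⟨$⟩ˡ k)
insert-punchIn⁻¹ i j π k = begin
  insert i j π ⟨$⟩ˡ punchIn j k
    ≡⟨ cong (λ l → insert i j π ⟨$⟩ˡ punchIn j l) (inverseʳ π) ⟨
  insert i j π ⟨$⟩ˡ punchIn j (π ⟨$⟩ʳ (π ⟨$⟩ˡ k))
    ≡⟨ cong (insert i j π ⟨$⟩ˡ_) (insert-punchIn i j π (π ⟨$⟩ˡ k)) ⟨
  insert i j π ⟨$⟩ˡ (insert i j π ⟨$⟩ʳ punchIn i (π ⟨$⟩ˡ k))
    ≡⟨ inverseˡ (insert i j π) ⟩
  punchIn i (π ⟨$⟩ˡ k) ∎

rearranged : (Fin n → A) → Permutation′ n → List A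
rearranged a π = tabulate (λ i → a (π ⟨$⟩ˡ i))

module _ (i : Fin (suc n)) (π : Permutation′ n) where

  private
    πᵢ = insert i (fromℕ n) π

  insert-max : (j : Fin (suc n)) → ¬ (πᵢ ⟨$⟩ʳ i Fin.< j)
  insert-max j πi<j =
    ℕ.<⇒≱ (subst (Fin._< j) (insert-at i (fromℕ n) π) πi<j) (Fin.≤fromℕ j)

  insert-<-max : (j : Fin n) → πᵢ ⟨$⟩ʳ punchIn i j Fin.< πᵢ ⟨$⟩ʳ i
  insert-<-max j
    rewrite insert-punchIn i (fromℕ n) π j | insert-at i (fromℕ n) π = punchIn-fromℕ-< (π ⟨$⟩ʳ j)

  insert-mono-< : (j k : Fin n) → π ⟨$⟩ʳ j Fin.< π ⟨$⟩ʳ k →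
    πᵢ ⟨$⟩ʳ punchIn i j Fin.< πᵢ ⟨$⟩ʳ punchIn i k
  insert-mono-< j k
    rewrite insert-punchIn i (fromℕ n) π j | insert-punchIn i (fromℕ n) π k = punchIn-mono-< (fromℕ n)

  insert-cancel-< : (j k : Fin n) → πᵢ ⟨$⟩ʳ punchIn i j Fin.< πᵢ ⟨$⟩ʳ punchIn i k →
    π ⟨$⟩ʳ j Fin.< π ⟨$⟩ʳ k
  insert-cancel-< j k
    rewrite insert-punchIn i (fromℕ n) π j | insert-punchIn i (fromℕ n) π k = punchIn-cancel-< (fromℕ n)

  -- The word lists the letters by value, so the letter at the position `i` of the largest value
  -- comes last.
  rearranged-insert : (a : Fin (suc n) → A) →
    rearranged a πᵢ ≡ rearranged (a ∘ punchIn i) π ∷ʳ a i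
  rearranged-insert a = trans (tabulate-∷ʳ (λ j → a (πᵢ ⟨$⟩ˡ j)))
    (cong₂ _∷ʳ_
      (tabulate-cong (λ j → cong a (insert-punchIn⁻¹ i (fromℕ n) π j)))
      (cong a (insert-at⁻¹ i (fromℕ n) π)))

  -- The largest value may only stand at the end of its block, which is
  -- expressed by the second hypothesis; the first one says that deleting
  -- position i turns blocks cut at k into blocks cut at k′.
  isShuffle-insert : ∀ {k k′} →
    (∀ j → toℕ (punchIn i j) < k ⇔ toℕ j < k′) →
    (∀ j → i Fin.< j → toℕ i < k × k ≤ toℕ j) →
    IsShuffle k πᵢ ⇔ IsShuffle k′ π
  isShuffle-insert {k} {k′} cut end = mk⇔
    (λ (inc₁ , inc₂) →
      (λ x y x<y y<k′ → insert-cancel-< x y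
        (inc₁ _ _ (punchIn-mono-< i x<y) (Equivalence.from (cut y) y<k′))) ,
      (λ x y x<y k′≤x → insert-cancel-< x y
        (inc₂ _ _ (punchIn-mono-< i x<y)
          (ℕ.≮⇒≥ (ℕ.≤⇒≯ k′≤x ∘ Equivalence.to (cut x))))))
    (λ (inc₁ , inc₂) → first inc₁ , second inc₂)
    where
    first : (∀ x y → x Fin.< y → toℕ y < k′ → π ⟨$⟩ʳ x Fin.< π ⟨$⟩ʳ y) →
      ∀ x y → x Fin.< y → toℕ y < k → πᵢ ⟨$⟩ʳ x Fin.< πᵢ ⟨$⟩ʳ y
    first inc₁ x y x<y y<k with punchIn-view i x | punchIn-view i y
    -- A maximum at `x` with `y` later in the same block is excluded by `end`; a maximum at `y`
    -- exceeds every other value.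
    ... | inj₁ refl       | _               = contradiction (proj₂ (end y x<y)) (ℕ.<⇒≱ y<k)
    ... | inj₂ (x′ , refl) | inj₁ refl       = insert-<-max x′
    ... | inj₂ (x′ , refl) | inj₂ (y′ , refl) =
      insert-mono-< x′ y′ (inc₁ x′ y′ (punchIn-cancel-< i x<y) (Equivalence.to (cut y′) y<k))
    second : (∀ x y → x Fin.< y → k′ ≤ toℕ x → π ⟨$⟩ʳ x Fin.< π ⟨$⟩ʳ y) →
      ∀ x y → x Fin.< y → k ≤ toℕ x → πᵢ ⟨$⟩ʳ x Fin.< πᵢ ⟨$⟩ʳ y
    second inc₂ x y x<y k≤x with punchIn-view i x | punchIn-view i y
    ... | inj₁ refl       | _               = contradiction k≤x (ℕ.<⇒≱ (proj₁ (end y x<y)))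
    ... | inj₂ (x′ , refl) | inj₁ refl       = insert-<-max x′
    ... | inj₂ (x′ , refl) | inj₂ (y′ , refl) =
      insert-mono-< x′ y′ (inc₂ x′ y′ (punchIn-cancel-< i x<y)
        (ℕ.≮⇒≥ (ℕ.≤⇒≯ k≤x ∘ Equivalence.from (cut x′))))

  -- Behind the last position of the first block there is only the second block, so the largest
  -- value at `i` conflicts with no later position.
  isShuffle-insert-block : IsShuffle (suc (toℕ i)) πᵢ ⇔ IsShuffle (toℕ i) π
  isShuffle-insert-block =
    isShuffle-insert (punchIn-<-suc⇔< i) (λ j i<j → ℕ.n<1+n (toℕ i) , i<j)

  -- Position `i` is neither the last one nor the end of the first block, so the next position lies
  -- in the same block and would need a value above the largest.
  ¬isShuffle-insert : ∀ {k} → toℕ i < n → suc (toℕ i) ≢ k → ¬ IsShuffle k πᵢ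
  ¬isShuffle-insert {k} i<n 1+i≢k (inc₁ , inc₂) with k ≤? toℕ i
  ... | yes k≤i = insert-max _ (inc₂ i (fromℕ< (s≤s i<n)) i<next k≤i)
    where
    i<next : i Fin.< fromℕ< (s≤s i<n)
    i<next = subst (toℕ i <_) (sym (Fin.toℕ-fromℕ< (s≤s i<n))) (ℕ.n<1+n (toℕ i))
  ... | no  k≰i = insert-max _ (inc₁ i (fromℕ< (s≤s i<n)) i<next next<k)
    where
    i<next : i Fin.< fromℕ< (s≤s i<n)
    i<next = subst (toℕ i <_) (sym (Fin.toℕ-fromℕ< (s≤s i<n))) (ℕ.n<1+n (toℕ i))
    next<k : toℕ (fromℕ< (s≤s i<n)) < k
    next<k = subst (_< k) (sym (Fin.toℕ-fromℕ< (s≤s i<n))) (ℕ.≤∧≢⇒< (ℕ.≰⇒> k≰i) 1+i≢k)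

-- Deletion of the last position moves no other, so the cut remains at `k`, also for `k` beyond `n`.
isShuffle-insert-fromℕ : (π : Permutation′ n) {k : ℕ} →
  IsShuffle k (insert (fromℕ n) (fromℕ n) π) ⇔ IsShuffle k π
isShuffle-insert-fromℕ {n} π {k} = isShuffle-insert (fromℕ n) π
  (λ j → mk⇔ (subst (_< k) (toℕ-punchIn-fromℕ j)) (subst (_< k) (sym (toℕ-punchIn-fromℕ j))))
  (λ j n<j → contradiction (Fin.≤fromℕ j) (ℕ.<⇒≱ n<j))

-- Inversions

∑-≤? : ∀ n m → ∑ {n} (λ j → guard (m ≤? toℕ j) 1) ≡ n ∸ m
∑-≤? zero    m       = sym (ℕ.0∸n≡0 m)
∑-≤? (suc n) zero    = cong suc (trans
  (sum-cong-≗ {n} (λ j → guard-⇔ (mk⇔ (λ _ → z≤n) (λ _ → z≤n)) (0 ≤? suc (toℕ j)) (0 ≤? toℕ j) 1))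
  (∑-≤? n 0))
∑-≤? (suc n) (suc m) = trans
  (sum-cong-≗ {n} (λ j →
    guard-⇔ (mk⇔ s≤s⁻¹ s≤s) (suc m ≤? suc (toℕ j)) (m ≤? toℕ j) 1))
  (∑-≤? n m)

-- In a double sum of indicators, `sum-remove` separates the pairs that involve a given position
-- from the others.
inv-∑ : (π : Permutation′ n) → inv π ≡ ∑ (λ i → ∑ (λ j → guard (inversion? π (i , j)) 1))
inv-∑ {n} π = begin
  inv π
    ≡⟨ length-sumOver (filter (inversion? π) (cartesianProduct (allFin n) (allFin n))) ⟩
  sumOver (filter (inversion? π) (cartesianProduct (allFin n) (allFin n))) (λ _ → 1)
    ≡⟨ sumOver-filter (inversion? π) (cartesianProduct (allFin n) (allFin n)) (λ _ → 1) ⟩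
  sumOver (cartesianProduct (allFin n) (allFin n)) (λ ij → guard (inversion? π ij) 1)
    ≡⟨ sumOver-cartesianProductWith _,_ (allFin n) (allFin n) _ ⟩
  sumOver (allFin n) (λ i → sumOver (allFin n) (λ j → guard (inversion? π (i , j)) 1))
    ≡⟨ sumOver-cong (allFin n) (λ i → sumOver-tabulate id (λ j → guard (inversion? π (i , j)) 1)) ⟩
  sumOver (allFin n) (λ i → ∑ (λ j → guard (inversion? π (i , j)) 1))
    ≡⟨ sumOver-tabulate {n = n} id (λ i → ∑ (λ j → guard (inversion? π (i , j)) 1)) ⟩
  ∑ (λ i → ∑ (λ j → guard (inversion? π (i , j)) 1)) ∎

-- The largest value at `i` is inverted with exactly the positions behind it, and the pairs avoiding
-- `i` keep the relative order they have in `π`.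
inv-insert : (i : Fin (suc n)) (π : Permutation′ n) →
  inv (insert i (fromℕ n) π) ≡ (n ∸ toℕ i) + inv π
inv-insert {n} i π = begin
  inv πᵢ
    ≡⟨ inv-∑ πᵢ ⟩
  ∑ (λ j → ∑ (I j))
    ≡⟨ sum-remove {i = i} (λ j → ∑ (I j)) ⟩
  ∑ (I i) + ∑ (λ j → ∑ (I (punchIn i j)))
    ≡⟨ cong₂ _+_ (sum-remove {i = i} (I i))
         (sum-cong-≗ (λ j → sum-remove {i = i} (I (punchIn i j)))) ⟩
  (I i i + ∑ (λ k → I i (punchIn i k))) +
  ∑ (λ j → I (punchIn i j) i + ∑ (λ k → I (punchIn i j) (punchIn i k)))
    -- The diagonal entry and the rest of column `i` vanish, row `i` counts the positions behind the
    -- maximum, and the remaining entries are those of `π`.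
    ≡⟨ cong₂ _+_
         (cong₂ _+_ (guard-¬ (inversion? πᵢ (i , i)) (λ (i<i , _) → ℕ.<-irrefl refl i<i))
           (sum-cong-≗ (λ k → guard-⇔ (after k) (inversion? πᵢ (i , punchIn i k)) (toℕ i ≤? toℕ k) 1)))
         (sum-cong-≗ (λ j → cong₂ _+_
           (guard-¬ (inversion? πᵢ (punchIn i j , i)) (λ (_ , max<) → insert-max i π _ max<))
           (sum-cong-≗ (λ k → guard-⇔ (other j k)
             (inversion? πᵢ (punchIn i j , punchIn i k)) (inversion? π (j , k)) 1)))) ⟩
  ∑ {n} (λ k → guard (toℕ i ≤? toℕ k) 1) + ∑ (λ j → ∑ (λ k → guard (inversion? π (j , k)) 1))
    ≡⟨ cong₂ _+_ (∑-≤? n (toℕ i)) (sym (inv-∑ π)) ⟩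
  (n ∸ toℕ i) + inv π ∎
  where
  πᵢ = insert i (fromℕ n) π
  I : Fin (suc n) → Fin (suc n) → ℕ
  I j k = guard (inversion? πᵢ (j , k)) 1
  after : ∀ k → Inversion πᵢ (i , punchIn i k) ⇔ toℕ i ≤ toℕ k
  after k = mk⇔ (λ (i<k , _) → Equivalence.to (<-punchIn⇔≤ i k) i<k)
    (λ i≤k → Equivalence.from (<-punchIn⇔≤ i k) i≤k , insert-<-max i π k)
  other : ∀ j k → Inversion πᵢ (punchIn i j , punchIn i k) ⇔ Inversion π (j , k)
  other j k = mk⇔
    (λ (j<k , πk<πj) → punchIn-cancel-< i j<k , insert-cancel-< i π k j πk<πj)
    (λ (j<k , πk<πj) → punchIn-mono-< i j<k , insert-mono-< i π k j πk<πj)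

-- The shuffle sum, split by the position of the largest value

⟪shuffleSum⟫ : (k : ℕ) (a : Fin n → A) (f : ℕ → List A → ℕ) →
  ⟪ shuffleSum k a ∣ f ⟫ ≡
  sumOver (𝔖 n) (λ π → guard (isShuffle? k π) (f (inv π) (rearranged a π)))
⟪shuffleSum⟫ {n} k a f = begin
  ⟪ shuffleSum k a ∣ f ⟫
    ≡⟨ sumOver-concatMap _ (filter (isShuffle? k) (𝔖 n)) _ ⟩
  sumOver (filter (isShuffle? k) (𝔖 n)) (λ π → ⟪ q^ inv π · word (rearranged a π) ∣ f ⟫)
    ≡⟨ sumOver-filter (isShuffle? k) (𝔖 n) _ ⟩
  sumOver (𝔖 n) (λ π → guard (isShuffle? k π) ⟪ q^ inv π · word (rearranged a π) ∣ f ⟫)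
    ≡⟨ sumOver-cong (𝔖 n) (λ π → guard-cong (isShuffle? k π) (begin
         ⟪ q^ inv π · word (rearranged a π) ∣ f ⟫
           ≡⟨ ⟪q^·⟫ (inv π) (word (rearranged a π)) f ⟩
         ⟪ word (rearranged a π) ∣ (λ j → f (inv π + j)) ⟫
           ≡⟨ ⟪word⟫ (rearranged a π) (λ j → f (inv π + j)) ⟩
         f (inv π + 0) (rearranged a π)
           ≡⟨ cong (λ j → f j (rearranged a π)) (ℕ.+-identityʳ (inv π)) ⟩
         f (inv π) (rearranged a π) ∎)) ⟩
  sumOver (𝔖 n) (λ π → guard (isShuffle? k π) (f (inv π) (rearranged a π))) ∎

-- The contribution of the permutations whose largest value is at position i.
slice : ℕ → (Fin (suc n) → A) → (ℕ → List A → ℕ) → Fin (suc n) → ℕ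
slice {n} k a f i = sumOver (𝔖 n) (λ π →
  guard (isShuffle? k (insert i (fromℕ n) π))
    (f ((n ∸ toℕ i) + inv π) (rearranged (a ∘ punchIn i) π ∷ʳ a i)))

-- `𝔖 (suc n)` is built by inserting the largest value at each position, so the split is that of its
-- definition; `inv-insert` and `rearranged-insert` supply exponent and word.
⟪shuffleSum⟫-slice : (k : ℕ) (a : Fin (suc n) → A) (f : ℕ → List A → ℕ) →
  ⟪ shuffleSum k a ∣ f ⟫ ≡ ∑ (slice k a f)
⟪shuffleSum⟫-slice {n} k a f = begin
  ⟪ shuffleSum k a ∣ f ⟫
    ≡⟨ ⟪shuffleSum⟫ k a f ⟩
  sumOver (𝔖 (suc n)) (λ π → guard (isShuffle? k π) (f (inv π) (rearranged a π)))
    ≡⟨ sumOver-cartesianProductWith (λ i π → insert i (fromℕ n) π) (allFin (suc n)) (𝔖 n) _ ⟩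
  sumOver (allFin (suc n)) (λ i → sumOver (𝔖 n) (λ π →
    guard (isShuffle? k (insert i (fromℕ n) π))
      (f (inv (insert i (fromℕ n) π)) (rearranged a (insert i (fromℕ n) π)))))
    ≡⟨ sumOver-cong (allFin (suc n)) (λ i → sumOver-cong (𝔖 n) (λ π →
         guard-cong (isShuffle? k (insert i (fromℕ n) π))
           (cong₂ f (inv-insert i π) (rearranged-insert i π a)))) ⟩
  sumOver (allFin (suc n)) (slice k a f)
    ≡⟨ sumOver-tabulate id (slice k a f) ⟩
  ∑ (slice k a f) ∎

-- An increasing block can have the largest value only at its end, which is the last position or the
-- `i` with `suc (toℕ i)` equal to `k`.
slice-0 : ∀ {k} (a : Fin (suc n) → A) f {i} → i ≢ fromℕ n → suc (toℕ i) ≢ k → slice k a f i ≡ 0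
slice-0 {n} {k = k} a f {i} i≢n 1+i≢k = trans
  (sumOver-cong (𝔖 n) (λ π → guard-¬ (isShuffle? k (insert i (fromℕ n) π))
    (¬isShuffle-insert i π (subst (toℕ i <_) (Fin.toℕ-fromℕ n) (Fin.≤∧≢⇒< (Fin.≤fromℕ i) i≢n)) 1+i≢k)))
  (sumOver-0 (𝔖 n))

slice-fromℕ : ∀ k (a : Fin (suc n) → A) f →
  slice k a f (fromℕ n) ≡
  ⟪ shuffleSum k (a ∘ punchIn (fromℕ n)) ∣ (λ j w → f j (w ∷ʳ a (fromℕ n))) ⟫
slice-fromℕ {n} k a f = trans
  (sumOver-cong (𝔖 n) (λ π → trans
    (guard-⇔ (isShuffle-insert-fromℕ π) (isShuffle? k (insert (fromℕ n) (fromℕ n) π)) (isShuffle? k π) _)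
    (guard-cong (isShuffle? k π)
      (cong (λ d → f (d + inv π) (rearranged (a ∘ punchIn (fromℕ n)) π ∷ʳ a (fromℕ n))) n∸n))))
  (sym (⟪shuffleSum⟫ k (a ∘ punchIn (fromℕ n)) _))
  where
  n∸n : n ∸ toℕ (fromℕ n) ≡ 0
  n∸n = trans (cong (n ∸_) (Fin.toℕ-fromℕ n)) (ℕ.n∸n≡0 n)

slice-block : (i : Fin (suc n)) (a : Fin (suc n) → A) (f : ℕ → List A → ℕ) →
  slice (suc (toℕ i)) a f i ≡
  ⟪ shuffleSum (toℕ i) (a ∘ punchIn i) ∣ (λ j w → f ((n ∸ toℕ i) + j) (w ∷ʳ a i)) ⟫
slice-block {n} i a f = trans
  (sumOver-cong (𝔖 n) (λ π → guard-⇔ (isShuffle-insert-block i π)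
    (isShuffle? (suc (toℕ i)) (insert i (fromℕ n) π)) (isShuffle? (toℕ i) π) _))
  (sym (⟪shuffleSum⟫ (toℕ i) (a ∘ punchIn i) _))

-- The hypothesis holds for `k` equal to 0 and for `k` greater than `n`, when one of the two blocks
-- is empty. Only the slice of the last position is then left.
⟪shuffleSum⟫-one-block : (k : ℕ) → (∀ i → i ≢ fromℕ n → suc (toℕ i) ≢ k) →
  (a : Fin (suc n) → A) (f : ℕ → List A → ℕ) →
  ⟪ shuffleSum k a ∣ f ⟫ ≡
  ⟪ shuffleSum k (a ∘ punchIn (fromℕ n)) ∣ (λ j w → f j (w ∷ʳ a (fromℕ n))) ⟫
⟪shuffleSum⟫-one-block {n} k 1+i≢k a f = begin
  ⟪ shuffleSum k a ∣ f ⟫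
    ≡⟨ ⟪shuffleSum⟫-slice k a f ⟩
  ∑ (slice k a f)
    ≡⟨ ∑-single (slice k a f) (fromℕ n) (λ i i≢n → slice-0 a f i≢n (1+i≢k i i≢n)) ⟩
  slice k a f (fromℕ n)
    ≡⟨ slice-fromℕ k a f ⟩
  _ ∎

-- The first block ends at `i` and the second at the last position. Their slices correspond to the
-- two terms of the recursion for `_⧢_`.
⟪shuffleSum⟫-two-blocks : (i : Fin (suc n)) → i ≢ fromℕ n →
  (a : Fin (suc n) → A) (f : ℕ → List A → ℕ) →
  ⟪ shuffleSum (suc (toℕ i)) a ∣ f ⟫ ≡
  ⟪ shuffleSum (toℕ i) (a ∘ punchIn i) ∣ (λ j w → f ((n ∸ toℕ i) + j) (w ∷ʳ a i)) ⟫ +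
  ⟪ shuffleSum (suc (toℕ i)) (a ∘ punchIn (fromℕ n)) ∣ (λ j w → f j (w ∷ʳ a (fromℕ n))) ⟫
⟪shuffleSum⟫-two-blocks {n} i i≢n a f = begin
  ⟪ shuffleSum (suc (toℕ i)) a ∣ f ⟫
    ≡⟨ ⟪shuffleSum⟫-slice (suc (toℕ i)) a f ⟩
  ∑ (slice (suc (toℕ i)) a f)
    ≡⟨ ∑-pair (slice (suc (toℕ i)) a f) i≢n (λ l l≢i l≢n →
         slice-0 a f l≢n (l≢i ∘ Fin.toℕ-injective ∘ ℕ.suc-injective)) ⟩
  slice (suc (toℕ i)) a f i + slice (suc (toℕ i)) a f (fromℕ n)
    ≡⟨ cong₂ _+_ (slice-block i a f) (slice-fromℕ (suc (toℕ i)) a f) ⟩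
  _ ∎

-- Induction on `n`, matching the recursion for `_⧢_` with the slices. Removing the last letter of
-- all keeps `k`, so the induction also passes through `k` greater than `n`, where the second word
-- is empty.
⟪⧢⟫-shuffleSum : ∀ n k (a : Fin n → A) (f : ℕ → List A → ℕ) →
  ⟪ take k (tabulate a) ⧢ drop k (tabulate a) ∣ f ⟫ ≡ ⟪ shuffleSum k a ∣ f ⟫
⟪⧢⟫-shuffleSum zero    k a f = begin
  ⟪ take k [] ⧢ drop k [] ∣ f ⟫
    ≡⟨ cong₂ (λ u v → ⟪ u ⧢ v ∣ f ⟫) (take-[] k) (drop-[] k) ⟩
  ⟪ [] ⧢ [] ∣ f ⟫
    ≡⟨ ⟪⧢-[]⟫ [] f ⟩
  f 0 []
    ≡⟨ ℕ.+-identityʳ (f 0 []) ⟨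
  f 0 [] + 0
    -- `𝔖 zero` lists the identity alone, for which `isShuffle?` computes to true and `inv` to 0.
    ≡⟨ ⟪shuffleSum⟫ k a f ⟨
  ⟪ shuffleSum k a ∣ f ⟫ ∎
⟪⧢⟫-shuffleSum (suc n) zero a f = begin
  ⟪ [] ⧢ tabulate a ∣ f ⟫
    ≡⟨ ⟪[]-⧢⟫ (tabulate a) f ⟩
  f 0 (tabulate a)
    ≡⟨ cong (f 0) (tabulate-∷ʳ a) ⟩
  f 0 (tabulate (a ∘ punchIn (fromℕ n)) ∷ʳ a (fromℕ n))
    ≡⟨ ⟪[]-⧢⟫ (tabulate (a ∘ punchIn (fromℕ n))) _ ⟨
  ⟪ [] ⧢ tabulate (a ∘ punchIn (fromℕ n)) ∣ (λ j w → f j (w ∷ʳ a (fromℕ n))) ⟫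
    ≡⟨ ⟪⧢⟫-shuffleSum n 0 (a ∘ punchIn (fromℕ n)) _ ⟩
  ⟪ shuffleSum 0 (a ∘ punchIn (fromℕ n)) ∣ (λ j w → f j (w ∷ʳ a (fromℕ n))) ⟫
    ≡⟨ ⟪shuffleSum⟫-one-block 0 (λ _ _ ()) a f ⟨
  ⟪ shuffleSum 0 a ∣ f ⟫ ∎
⟪⧢⟫-shuffleSum (suc n) (suc k) a f with suc k ≤? n
-- The second word is empty, here and after the last letter is removed, so both shuffles are single
-- words.
... | no 1+k≰n = begin
  ⟪ take (suc k) (tabulate a) ⧢ drop (suc k) (tabulate a) ∣ f ⟫
    ≡⟨ all (suc n) (ℕ.≰⇒> 1+k≰n) a f ⟩
  f 0 (tabulate a)
    ≡⟨ cong (f 0) (tabulate-∷ʳ a) ⟩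
  f 0 (tabulate (a ∘ punchIn (fromℕ n)) ∷ʳ a (fromℕ n))
    ≡⟨ all n (ℕ.<⇒≤ (ℕ.≰⇒> 1+k≰n)) (a ∘ punchIn (fromℕ n)) _ ⟨
  ⟪ take (suc k) (tabulate (a ∘ punchIn (fromℕ n))) ⧢ drop (suc k) (tabulate (a ∘ punchIn (fromℕ n)))
    ∣ (λ j w → f j (w ∷ʳ a (fromℕ n))) ⟫
    ≡⟨ ⟪⧢⟫-shuffleSum n (suc k) (a ∘ punchIn (fromℕ n)) _ ⟩
  ⟪ shuffleSum (suc k) (a ∘ punchIn (fromℕ n)) ∣ (λ j w → f j (w ∷ʳ a (fromℕ n))) ⟫
    ≡⟨ ⟪shuffleSum⟫-one-block (suc k) (λ i i≢n 1+i≡1+k → 1+k≰n (subst (_≤ n) 1+i≡1+k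
         (subst (toℕ i <_) (Fin.toℕ-fromℕ n) (Fin.≤∧≢⇒< (Fin.≤fromℕ i) i≢n)))) a f ⟨
  ⟪ shuffleSum (suc k) a ∣ f ⟫ ∎
  where
  all : ∀ m → m ≤ suc k → (b : Fin m → _) (g : ℕ → List _ → ℕ) →
    ⟪ take (suc k) (tabulate b) ⧢ drop (suc k) (tabulate b) ∣ g ⟫ ≡ g 0 (tabulate b)
  all m m≤1+k b g = trans
    (cong₂ (λ u v → ⟪ u ⧢ v ∣ g ⟫)
      (take-all (suc k) (tabulate b) (subst (_≤ suc k) (sym (length-tabulate b)) m≤1+k))
      (drop-all (suc k) (tabulate b) (subst (_≤ suc k) (sym (length-tabulate b)) m≤1+k)))
    (⟪⧢-[]⟫ (tabulate b) g)
-- The cut is written as `suc (toℕ i)` with `i` the last position of the first block, since slices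
-- are indexed by positions; `subst` returns to `k`.
... | yes 1+k≤n = subst
  (λ l → ⟪ take (suc l) (tabulate a) ⧢ drop (suc l) (tabulate a) ∣ f ⟫ ≡
         ⟪ shuffleSum (suc l) a ∣ f ⟫)
  (Fin.toℕ-fromℕ< k<1+n)
  (begin
    ⟪ take (suc (toℕ i)) aw ⧢ drop (suc (toℕ i)) aw ∣ f ⟫
      ≡⟨ cong₂ (λ u v → ⟪ u ⧢ v ∣ f ⟫) (take-suc-tabulate a i) drop-aw ⟩
    ⟪ (take (toℕ i) aw ∷ʳ a i) ⧢ (drop (suc (toℕ i)) aw′ ∷ʳ a (fromℕ n)) ∣ f ⟫
      ≡⟨ ⟪⧢-∷ʳ⟫ (take (toℕ i) aw) (drop (suc (toℕ i)) aw′) (a i) (a (fromℕ n)) f ⟩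
    ⟪ take (toℕ i) aw ⧢ (drop (suc (toℕ i)) aw′ ∷ʳ a (fromℕ n)) ∣
      (λ j w → f (length (drop (suc (toℕ i)) aw′ ∷ʳ a (fromℕ n)) + j) (w ∷ʳ a i)) ⟫ +
    ⟪ (take (toℕ i) aw ∷ʳ a i) ⧢ drop (suc (toℕ i)) aw′ ∣ (λ j w → f j (w ∷ʳ a (fromℕ n))) ⟫
      ≡⟨ cong₂ _+_
           -- The exponent from the recursion, the length of the second word, is
           -- `suc n ∸ suc (toℕ i)`, which computes to the number `n ∸ toℕ i` of inversions of the
           -- largest value.
           (cong₂ (λ l s → ⟪ s ∣ (λ j w → f (l + j) (w ∷ʳ a i)) ⟫)
             (trans (cong length (sym drop-aw))
               (trans (length-drop (suc (toℕ i)) aw) (cong (_∸ suc (toℕ i)) (length-tabulate a))))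
             (cong₂ _⧢_ (sym (take-tabulate-punchIn a i))
               (trans (sym drop-aw) (sym (drop-tabulate-punchIn a i)))))
           (cong (λ u → ⟪ u ⧢ drop (suc (toℕ i)) aw′ ∣ (λ j w → f j (w ∷ʳ a (fromℕ n))) ⟫)
             (trans (sym (take-suc-tabulate a i)) take-aw)) ⟩
    ⟪ take (toℕ i) (tabulate (a ∘ punchIn i)) ⧢ drop (toℕ i) (tabulate (a ∘ punchIn i)) ∣
      (λ j w → f ((n ∸ toℕ i) + j) (w ∷ʳ a i)) ⟫ +
    ⟪ take (suc (toℕ i)) aw′ ⧢ drop (suc (toℕ i)) aw′ ∣ (λ j w → f j (w ∷ʳ a (fromℕ n))) ⟫
      ≡⟨ cong₂ _+_ (⟪⧢⟫-shuffleSum n (toℕ i) (a ∘ punchIn i) _)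
                   (⟪⧢⟫-shuffleSum n (suc (toℕ i)) (a ∘ punchIn (fromℕ n)) _) ⟩
    ⟪ shuffleSum (toℕ i) (a ∘ punchIn i) ∣ (λ j w → f ((n ∸ toℕ i) + j) (w ∷ʳ a i)) ⟫ +
    ⟪ shuffleSum (suc (toℕ i)) (a ∘ punchIn (fromℕ n)) ∣ (λ j w → f j (w ∷ʳ a (fromℕ n))) ⟫
      ≡⟨ ⟪shuffleSum⟫-two-blocks i i≢n a f ⟨
    ⟪ shuffleSum (suc (toℕ i)) a ∣ f ⟫ ∎)
  where
  k<1+n : k < suc n
  k<1+n = ℕ.m≤n⇒m≤1+n 1+k≤n
  i : Fin (suc n)
  i = fromℕ< k<1+n
  i<n : toℕ i < n
  i<n = subst (_< n) (sym (Fin.toℕ-fromℕ< k<1+n)) 1+k≤n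
  i≢n : i ≢ fromℕ n
  i≢n i≡n = ℕ.<⇒≢ i<n (trans (cong toℕ i≡n) (Fin.toℕ-fromℕ n))
  aw = tabulate a
  aw′ = tabulate (a ∘ punchIn (fromℕ n))
  i<|aw′| : toℕ i < length aw′
  i<|aw′| = subst (toℕ i <_) (sym (length-tabulate (a ∘ punchIn (fromℕ n)))) i<n
  take-aw : take (suc (toℕ i)) aw ≡ take (suc (toℕ i)) aw′
  take-aw = trans (cong (take (suc (toℕ i))) (tabulate-∷ʳ a))
    (take-++-≤ (suc (toℕ i)) aw′ _ i<|aw′|)
  drop-aw : drop (suc (toℕ i)) aw ≡ drop (suc (toℕ i)) aw′ ∷ʳ a (fromℕ n)
  drop-aw = trans (cong (drop (suc (toℕ i))) (tabulate-∷ʳ a))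
    (drop-++-≤ (suc (toℕ i)) aw′ _ i<|aw′|)

corollary5p3 : ∀ {ℓ} {A : Set ℓ} {m : ℕ} (finite : A ↔ Fin m) →
    (∀ (k n : ℕ) → k ≤ n → (a : Fin n → A) →
    (take k (tabulate a) ⧢ drop k (tabulate a)) ≈[ finite ] shuffleSum k a) ×
    (∀ (s t r : ℕ[q]⟨ A *⟩) →
    ((s ⧢̂ t) ⧢̂ r) ≈[ finite ] (s ⧢̂ (t ⧢̂ r)))
corollary5p3 finite =
  (λ k n _ a → ⟪⟫-≈ finite (take k (tabulate a) ⧢ drop k (tabulate a)) (shuffleSum k a)
    (⟪⧢⟫-shuffleSum n k a)) ,
  (λ s t r → ⟪⟫-≈ finite ((s ⧢̂ t) ⧢̂ r) (s ⧢̂ (t ⧢̂ r)) (⟪⧢̂⟫-assoc s t r))
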